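{- Let $p$ be a prime and let $m,k,n,a,b,c,u$ be positive integers with $q=p^m$, $k\mid q-1$, $n=\frac{q-1}{k}$, $m=ab$, $n=bc$, $b>1$, $c\mid p^a-1$ and $u=\frac{p^a-1}{c}$. Assume that $c$ is a primitive divisor of $p^a-1$ and $n$ is a primitive divisor of $p^m-1$. Consider the irreducible cyclic codes $\mathcal C=\mathcal C(k,p^m)$ and $\mathcal C_0=\mathcal C(u,p^a)$. If $p-1\mid c$, then the weight distribution of $\mathcal C$ is determined by that of $\mathcal C_0$. More precisely, if the weights of $\mathcal C_0$ are $w_1,\dots,w_s$ (the distinct values taken by weights of codewords of $\mathcal C_0$) with frequencies $A_{w_i}=m_i$ for $i=1,\dots,s$, then the weights of $\mathcal C$ are $$w_{\ell_1,\dots,\ell_s}=\ell_1w_1+\cdots+\ell_sw_s,$$ where $(\ell_1,\dots,\ell_s)\in\mathbb N_0^s$ with $\ell_1+\cdots+\ell_s=b$, with frequencies $$A_{\ell_1,\dots,\ell_s}=\binom{b}{\ell_1,\dots,\ell_s}m_1^{\ell_1}\cdots m_s^{\ell_s}.$$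
   Context: For a prime $p$, $q=p^m$, $k\mid q-1$ and $n=\frac{q-1}{k}$, the $p$-ary irreducible cyclic code is $\mathcal C(k,q)=\{(\mathrm{Tr}_{q/p}(\gamma\,\omega^{ki}))_{i=0}^{n-1}:\gamma\in\mathbb F_q\}$, where $\omega$ is a primitive element of $\mathbb F_q$ and $\mathrm{Tr}_{q/p}$ is the trace. The weight of a codeword is its number of nonzero coordinates; the frequency $A_w$ of a weight $w$ is the number of codewords of weight $w$. An integer $d$ is a primitive divisor of $p^m-1$ if $d\mid p^m-1$ and $d\nmid p^t-1$ for all $1\le t<m$. $\binom{b}{\ell_1,\dots,\ell_s}$ is the multinomial coefficient. -}

module Defs where

open import Level using (0ℓ)
open import Data.Nat using (ℕ; zero; suc; _+_; _*_; _∸_; _^_)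
open import Data.Nat.Divisibility using (_∣_)
open import Data.Nat.Combinatorics using (_C_)
import Data.Nat.ListAction
open import Data.Fin using (Fin; toℕ)
open import Data.List using (List; []; _∷_; [_]; map; concatMap; upTo; allFin; deduplicate; filter; length)
open import Data.Vec as Vec using (Vec; tabulate; zipWith)
import Data.Vec.Properties as VecP
open import Data.Product using (∃)
open import Function.Bundles using (_↔_; Inverse)
open import Relation.Binary.PropositionalEquality using (_≡_; _≢_)
open import Relation.Binary.Definitions using (DecidableEquality)
open import Relation.Nullary using (¬_; ¬?; does)
open import Data.Bool using (if_then_else_)
open import Algebra.Structures using (IsCommutativeRing)

record FiniteField : Set₁ where
  infixl 7 _⊗_
  infixl 6 _⊕_
  field
    Carrier : Set
    _⊕_ _⊗_ : Carrier → Carrier → Carrier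
    ⊖_ : Carrier → Carrier
    0# 1# : Carrier
    isCommutativeRing : IsCommutativeRing _≡_ _⊕_ _⊗_ ⊖_ 0# 1#
    0≢1 : 0# ≢ 1#
    inverse : ∀ x → x ≢ 0# → ∃ λ y → x ⊗ y ≡ 1#
    _≟_ : DecidableEquality Carrier
    size : ℕ
    enum : Fin size ↔ Carrier

  elements : List Carrier
  elements = map (Inverse.to enum) (allFin size)

  pow : Carrier → ℕ → Carrier
  pow x zero = 1#
  pow x (suc j) = x ⊗ pow x j

  fsum : List Carrier → Carrier
  fsum [] = 0#
  fsum (x ∷ xs) = x ⊕ fsum xs

  IsPrimitive : Carrier → Set
  IsPrimitive ω = ∀ x → x ≢ 0# → ∃ λ j → pow ω j ≡ x

  trace : (p m : ℕ) → Carrier → Carrier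
  trace p m x = fsum (map (λ j → pow x (p ^ j)) (upTo m))

  codeword : (p m k n : ℕ) → Carrier → Carrier → Vec Carrier n
  codeword p m k n ω γ = tabulate (λ i → trace p m (γ ⊗ pow ω (k * toℕ i)))

  code : (p m k n : ℕ) → Carrier → List (Vec Carrier n)
  code p m k n ω = deduplicate (VecP.≡-dec _≟_) (map (codeword p m k n ω) elements)

  weight : ∀ {n} → Vec Carrier n → ℕ
  weight v = length (filter (λ x → ¬? (x ≟ 0#)) (Vec.toList v))

  IsWeight : (p m k n : ℕ) → Carrier → ℕ → Set
  IsWeight p m k n ω w = ∃ λ γ → weight (codeword p m k n ω γ) ≡ w

  freq : (p m k n : ℕ) → Carrier → ℕ → ℕ
  freq p m k n ω w = length (filter (λ v → weight v Data.Nat.≟ w) (code p m k n ω))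

IsPrimitiveDivisor : ℕ → ℕ → ℕ → Set
IsPrimitiveDivisor d p m = (d ∣ p ^ m ∸ 1) × (∀ t → 1 Data.Nat.≤ t → t Data.Nat.< m → ¬ (d ∣ p ^ t ∸ 1))
  where open import Data.Product using (_×_)

compositions : (s b : ℕ) → List (Vec ℕ s)
compositions zero zero = [ Vec.[] ]
compositions zero (suc b) = []
compositions (suc s) b = concatMap (λ i → map (i Vec.∷_) (compositions s (b ∸ i))) (upTo (suc b))

multinomial : ∀ {s} → Vec ℕ s → ℕ
multinomial Vec.[] = 1
multinomial (l Vec.∷ ls) = ((l + Vec.sum ls) C l) * multinomial ls

predictedFreq : ∀ {s} → (b : ℕ) → (ws ms : Vec ℕ s) → ℕ → ℕ
predictedFreq {s} b ws ms w =
  Data.Nat.ListAction.sum (map term (compositions s b))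
  where
  term : Vec ℕ s → ℕ
  term ℓ = if does (Vec.sum (zipWith _*_ ℓ ws) Data.Nat.≟ w)
           then multinomial ℓ * Vec.foldr _ _*_ 1 (zipWith _^_ ms ℓ)
           else 0

{-# OPTIONS --safe #-}

-- Put g = ω^k, of order n = bc. Its power h = g^b has order c ∣ p^a - 1, so it lies in the
-- subfield K of F of order p^a. With T the trace from F to K, transitivity of traces gives
--   Tr (γ g^(jb + r)) = Tr_{K/p} (T (γ g^r) h^j),
-- so the codeword of γ interleaves b codewords of the code of (K, h), namely those of the
-- elements T (γ g^r), r < b. As n is a primitive divisor of p^m - 1, the conjugates of g are
-- distinct, hence γ ↦ codeword is injective (Vandermonde), hence so is γ ↦ (T (γ g^r))_r, and
-- by counting it is a bijection F → K^b. Up to a permutation of coordinates the code of (K, h)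
-- is that of F₀, because K ≅ F₀ and c-th roots of unity correspond; the frequencies then come
-- from the multinomial expansion.
--
-- The embedding F₀ → F sends ω₀ to a root of its minimal polynomial. Such a root exists: if
-- for every x ∈ F some f_x over the prime field vanished at ω₀ but not at x, then
-- ∏ₓ (1 - f_x^(q-1)) would vanish on F, hence be divisible by X^q - X and vanish at ω₀, where
-- its value is 1.

module Submission where

open import Defs
open import Algebra.Bundles using (CommutativeRing)
import Algebra.Properties.CommutativeSemiring.Binomial
import Algebra.Properties.Group
import Algebra.Properties.Ring
import Algebra.Properties.Semiring.Exp
import Algebra.Properties.Semiring.Mult
import Algebra.Properties.Semiring.Sum
import Algebra.Solver.Ring.NaturalCoefficients.Default
open import Algebra.Structures using (IsCommutativeMonoid)
open import Data.Bool using (Bool; true; false; if_then_else_)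
open import Data.Empty using (⊥; ⊥-elim)
open import Data.Fin using (Fin; toℕ; inject₁; fromℕ)
import Data.Fin as Fin
import Data.Fin.Properties as Fin
open import Data.List using (List; []; _∷_; [_]; _++_; map; concatMap; applyUpTo; upTo; allFin; replicate; filter; length; deduplicate)
import Data.List.Properties as List
open import Data.List.Membership.Propositional using (_∈_; find; lose)
open import Data.List.Membership.Propositional.Properties using (∈-∃++; ∈-map⁺; ∈-map⁻; ∈-concatMap⁺; ∈-concatMap⁻; ∈-upTo⁺; ∈-upTo⁻; ∈-allFin)
open import Data.List.Relation.Binary.Permutation.Propositional using (_↭_; refl; prep; swap; trans; ↭-sym; ↭-trans; ↭-reflexive)
open import Data.List.Relation.Binary.Permutation.Propositional.Properties using (shift; ↭-length; ∈-resp-↭)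
open import Data.List.Relation.Unary.All using (All; []; _∷_)
import Data.List.Relation.Unary.All as All
import Data.List.Relation.Unary.All.Properties as All
open import Data.List.Relation.Unary.AllPairs using ([]; _∷_)
open import Data.List.Relation.Unary.Any using (here; there; any?)
open import Data.List.Relation.Unary.Unique.Propositional using (Unique)
import Data.List.Relation.Unary.Unique.Propositional.Properties as Unique
open import Data.Nat using (ℕ; zero; suc; _+_; _*_; _∸_; _^_; _≤_; _<_; z≤n; s≤s; _!; NonZero; _%_; _/_)
import Data.Nat as ℕ
open import Data.Nat.Combinatorics using (_C_; nCk≡n!/k![n-k]!; k![n∸k]!∣n!; nCn≡1; nCk+nC[k+1]≡[n+1]C[k+1]; k>n⇒nCk≡0)
open import Data.Nat.Coprimality using (prime⇒coprime; coprime-Bézout)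
open import Data.Nat.Divisibility using (_∣_; divides; ∣⇒≤; ∣1⇒≡1; n∣m*n; m∣m*n; m%n≡0⇒n∣m; *-cancelˡ-∣; *-cancelʳ-∣)
open import Data.Nat.DivMod using (m≡m%n+[m/n]*n; m%n<n; m/n*n≡m)
open import Data.Nat.GCD using (module Bézout)
import Data.Nat.ListAction as ℕ
open import Data.Nat.Primality using (Prime; euclidsLemma; prime⇒nonZero; prime⇒nonTrivial)
import Data.Nat.Properties as ℕ
open import Data.Nat.Tactic.RingSolver using (solve-∀)
open import Data.Product using (∃; _×_; _,_; proj₁; proj₂)
open import Data.Sum using (inj₁; inj₂)
open import Data.Vec as Vec using (Vec; []; _∷_; lookup)
import Data.Vec.Functional as Vector
import Data.Vec.Properties as Vec
open import Function using (_∘_; id)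
open import Function.Bundles using (_⇔_; Equivalence; Inverse)
open import Level using (0ℓ)
open import Relation.Binary.Definitions using (DecidableEquality)
open import Relation.Binary.PropositionalEquality as ≡ using (_≡_; _≢_; refl; sym; cong; cong₂; subst)
open import Relation.Nullary using (¬_; Dec; yes; no; does; ¬?; contradiction)
open import Relation.Nullary.Decidable using (dec-false; dec-true; decidable-stable)
open import Relation.Unary using (Decidable)

-- `F₀` and `F` are unrelated fields, each with a generator chosen on its own, so the subfield K
-- must be matched with `F₀` by constructing a homomorphism. No minimal or irreducible polynomial is
-- computed for this. Polynomials get coefficients in ℕ, so that the same expression can be
-- evaluated in both fields; in characteristic p a subtraction becomes the addition of `p ∸ 1`
-- copies. The root that replaces ω₀ is obtained only up to double negation, since satisfying every
-- relation of ω₀ is a condition on infinitely many polynomials. This suffices, because the goal is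
-- an equation between natural numbers and hence stable. A frequency counts distinct codewords,
-- whereas the bijection F → K^b counts field elements. The two agree once γ ↦ codeword is
-- injective, so the Vandermonde argument is applied to both codes: with n and p^m for the large
-- one, with c and p^a for the small one.

-- Finite sums over lists in a commutative monoid

module BigSum {A : Set} {_∙_ : A → A → A} {ε : A} (isCM : IsCommutativeMonoid _≡_ _∙_ ε) where
  open IsCommutativeMonoid isCM using (assoc; comm; identityˡ; identityʳ)
  open ≡.≡-Reasoning

  private variable
    B C : Set

  ∑ : List B → (B → A) → A
  ∑ []       f = ε
  ∑ (x ∷ xs) f = f x ∙ ∑ xs f

  ∑-cong : ∀ (xs : List B) {f g} → (∀ x → x ∈ xs → f x ≡ g x) → ∑ xs f ≡ ∑ xs g
  ∑-cong []       f≗g = refl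
  ∑-cong (x ∷ xs) f≗g = cong₂ _∙_ (f≗g x (here refl)) (∑-cong xs λ y y∈ → f≗g y (there y∈))

  ∑-ε : ∀ (xs : List B) → ∑ xs (λ _ → ε) ≡ ε
  ∑-ε []       = refl
  ∑-ε (x ∷ xs) = ≡.trans (identityˡ _) (∑-ε xs)

  interchange : ∀ w x y z → (w ∙ x) ∙ (y ∙ z) ≡ (w ∙ y) ∙ (x ∙ z)
  interchange w x y z = begin
    (w ∙ x) ∙ (y ∙ z)  ≡⟨ assoc w x (y ∙ z) ⟩
    w ∙ (x ∙ (y ∙ z))  ≡⟨ cong (w ∙_) (assoc x y z) ⟨
    w ∙ ((x ∙ y) ∙ z)  ≡⟨ cong (λ v → w ∙ (v ∙ z)) (comm x y) ⟩
    w ∙ ((y ∙ x) ∙ z)  ≡⟨ cong (w ∙_) (assoc y x z) ⟩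
    w ∙ (y ∙ (x ∙ z))  ≡⟨ assoc w y (x ∙ z) ⟨
    (w ∙ y) ∙ (x ∙ z)  ∎

  ∑-∙ : ∀ (xs : List B) f g → ∑ xs (λ x → f x ∙ g x) ≡ ∑ xs f ∙ ∑ xs g
  ∑-∙ []       f g = sym (identityˡ ε)
  ∑-∙ (x ∷ xs) f g = ≡.trans (cong ((f x ∙ g x) ∙_) (∑-∙ xs f g)) (interchange _ _ _ _)

  ∑-swap : ∀ (xs : List B) (ys : List C) (f : B → C → A) →
           ∑ xs (λ x → ∑ ys (f x)) ≡ ∑ ys (λ y → ∑ xs (λ x → f x y))
  ∑-swap []       ys f = sym (∑-ε ys)
  ∑-swap (x ∷ xs) ys f =
    ≡.trans (cong (∑ ys (f x) ∙_) (∑-swap xs ys f)) (sym (∑-∙ ys (f x) _))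

  ∑-++ : ∀ (xs ys : List B) f → ∑ (xs ++ ys) f ≡ ∑ xs f ∙ ∑ ys f
  ∑-++ []       ys f = sym (identityˡ _)
  ∑-++ (x ∷ xs) ys f = ≡.trans (cong (f x ∙_) (∑-++ xs ys f)) (sym (assoc _ _ _))

  ∑-map : ∀ (h : B → C) xs f → ∑ (map h xs) f ≡ ∑ xs (f ∘ h)
  ∑-map h []       f = refl
  ∑-map h (x ∷ xs) f = cong (f (h x) ∙_) (∑-map h xs f)

  ∑-concatMap : ∀ (h : B → List C) xs f → ∑ (concatMap h xs) f ≡ ∑ xs (λ x → ∑ (h x) f)
  ∑-concatMap h []       f = refl
  ∑-concatMap h (x ∷ xs) f =
    ≡.trans (∑-++ (h x) (concatMap h xs) f) (cong (∑ (h x) f ∙_) (∑-concatMap h xs f))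

  ∑-↭ : ∀ {xs ys : List B} f → xs ↭ ys → ∑ xs f ≡ ∑ ys f
  ∑-↭ f refl         = refl
  ∑-↭ f (prep x p)   = cong (f x ∙_) (∑-↭ f p)
  ∑-↭ f (swap x y p) = begin
    f x ∙ (f y ∙ _)  ≡⟨ assoc _ _ _ ⟨
    (f x ∙ f y) ∙ _  ≡⟨ cong₂ _∙_ (comm (f x) (f y)) (∑-↭ f p) ⟩
    (f y ∙ f x) ∙ _  ≡⟨ assoc _ _ _ ⟩
    f y ∙ (f x ∙ _)  ∎
  ∑-↭ f (trans p q)  = ≡.trans (∑-↭ f p) (∑-↭ f q)

  ∑-upTo-suc : ∀ n f → ∑ (upTo (suc n)) f ≡ f 0 ∙ ∑ (upTo n) (f ∘ suc)
  ∑-upTo-suc n f = cong (f 0 ∙_) (begin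
    ∑ (applyUpTo suc n) f  ≡⟨ cong (λ xs → ∑ xs f) (List.map-upTo suc n) ⟨
    ∑ (map suc (upTo n)) f           ≡⟨ ∑-map suc (upTo n) f ⟩
    ∑ (upTo n) (f ∘ suc)             ∎)

  ∑-upTo-+ : ∀ m n f → ∑ (upTo (m + n)) f ≡ ∑ (upTo m) f ∙ ∑ (upTo n) (λ i → f (m + i))
  ∑-upTo-+ zero    n f = sym (identityˡ _)
  ∑-upTo-+ (suc m) n f = begin
    ∑ (upTo (suc (m + n))) f
      ≡⟨ ∑-upTo-suc (m + n) f ⟩
    f 0 ∙ ∑ (upTo (m + n)) (f ∘ suc)
      ≡⟨ cong (f 0 ∙_) (∑-upTo-+ m n (f ∘ suc)) ⟩
    f 0 ∙ (∑ (upTo m) (f ∘ suc) ∙ ∑ (upTo n) (λ i → f (suc (m + i))))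
      ≡⟨ assoc _ _ _ ⟨
    (f 0 ∙ ∑ (upTo m) (f ∘ suc)) ∙ ∑ (upTo n) (λ i → f (suc (m + i)))
      ≡⟨ cong (_∙ ∑ (upTo n) (λ i → f (suc (m + i)))) (∑-upTo-suc m f) ⟨
    ∑ (upTo (suc m)) f ∙ ∑ (upTo n) (λ i → f (suc (m + i)))  ∎

  ∑-upTo-∷ʳ : ∀ n f → ∑ (upTo (suc n)) f ≡ ∑ (upTo n) f ∙ f n
  ∑-upTo-∷ʳ n f = begin
    ∑ (upTo (suc n)) f             ≡⟨ cong (λ xs → ∑ xs f) (List.upTo-∷ʳ n) ⟨
    ∑ (upTo n ++ [ n ]) f          ≡⟨ ∑-++ (upTo n) [ n ] f ⟩
    ∑ (upTo n) f ∙ (f n ∙ ε)       ≡⟨ cong (∑ (upTo n) f ∙_) (identityʳ (f n)) ⟩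
    ∑ (upTo n) f ∙ f n             ∎

  ∑-upTo-* : ∀ m n f →
             ∑ (upTo (m * n)) f ≡ ∑ (upTo m) (λ i → ∑ (upTo n) (λ j → f (i * n + j)))
  ∑-upTo-* zero    n f = refl
  ∑-upTo-* (suc m) n f = begin
    ∑ (upTo (n + m * n)) f
      ≡⟨ ∑-upTo-+ n (m * n) f ⟩
    ∑ (upTo n) f ∙ ∑ (upTo (m * n)) (λ i → f (n + i))
      ≡⟨ cong (∑ (upTo n) f ∙_) (∑-upTo-* m n (λ i → f (n + i))) ⟩
    ∑ (upTo n) f ∙ ∑ (upTo m) (λ i → ∑ (upTo n) (λ j → f (n + (i * n + j))))
      ≡⟨ cong (∑ (upTo n) f ∙_) (∑-cong (upTo m) λ i _ → ∑-cong (upTo n) λ j _ →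
           cong f (sym (ℕ.+-assoc n (i * n) j))) ⟩
    ∑ (upTo n) f ∙ ∑ (upTo m) (λ i → ∑ (upTo n) (λ j → f (suc i * n + j)))
      ≡⟨ ∑-upTo-suc m _ ⟨
    ∑ (upTo (suc m)) (λ i → ∑ (upTo n) (λ j → f (i * n + j)))  ∎

module BigSumHom
  {A B : Set} {_∙_ : A → A → A} {ε : A} {_∘′_ : B → B → B} {ε′ : B}
  (isCM : IsCommutativeMonoid _≡_ _∙_ ε) (isCM′ : IsCommutativeMonoid _≡_ _∘′_ ε′)
  (h : A → B) (h-ε : h ε ≡ ε′) (h-∙ : ∀ x y → h (x ∙ y) ≡ h x ∘′ h y)
  where
  private
    module M = BigSum isCM
    module N = BigSum isCM′

  ∑-hom : {C : Set} (xs : List C) (f : C → A) → h (M.∑ xs f) ≡ N.∑ xs (h ∘ f)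
  ∑-hom []       f = h-ε
  ∑-hom (x ∷ xs) f = ≡.trans (h-∙ _ _) (cong (h (f x) ∘′_) (∑-hom xs f))

-- Finite sets as duplicate-free lists

module _ {A : Set} where

  unique-⊆⇒↭-++ : ∀ {xs ys : List A} → Unique xs → (∀ {x} → x ∈ xs → x ∈ ys) →
                  ∃ λ zs → ys ↭ xs ++ zs
  unique-⊆⇒↭-++ {[]}     {ys} []         xs⊆ys = ys , refl
  unique-⊆⇒↭-++ {x ∷ xs} {ys} (x≢ ∷ xs!) xs⊆ys with ∈-∃++ (xs⊆ys (here refl))
  ... | as , bs , refl with unique-⊆⇒↭-++ xs! xs⊆as++bs
    where
    xs⊆as++bs : ∀ {y} → y ∈ xs → y ∈ as ++ bs
    xs⊆as++bs {y} y∈xs with ∈-resp-↭ (shift x as bs) (xs⊆ys (there y∈xs))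
    ... | here refl = contradiction refl (All.lookup x≢ y∈xs)
    ... | there y∈  = y∈
  ... | zs , p = zs , ↭-trans (shift x as bs) (prep x p)

  unique-⊆⇒length≤ : ∀ {xs ys : List A} → Unique xs → (∀ {x} → x ∈ xs → x ∈ ys) →
                     length xs ≤ length ys
  unique-⊆⇒length≤ {xs} {ys} xs! xs⊆ys with unique-⊆⇒↭-++ xs! xs⊆ys
  ... | zs , p = subst (length xs ≤_)
    (sym (≡.trans (↭-length p) (List.length-++ xs))) (ℕ.m≤m+n (length xs) (length zs))

  -- Bijections enter the proof in this form: an injective image of the right length is a
  -- permutation of the target, so surjectivity is never shown directly and sums can be reindexed by
  -- `∑-↭`.
  unique-⊆⇒↭ : ∀ {xs ys : List A} → Unique xs → (∀ {x} → x ∈ xs → x ∈ ys) →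
               length xs ≡ length ys → xs ↭ ys
  unique-⊆⇒↭ {xs} {ys} xs! xs⊆ys eq with unique-⊆⇒↭-++ xs! xs⊆ys
  ... | []     , p = ↭-sym (↭-trans p (↭-reflexive (List.++-identityʳ xs)))
  ... | z ∷ zs , p = contradiction
    (≡.trans eq (≡.trans (↭-length p) (List.length-++ xs))) (ℕ.m≢1+m+n (length xs) ∘ λ e →
      ≡.trans e (ℕ.+-suc (length xs) (length zs)))

  -- `code` removes repeated codewords; when γ ↦ codeword is injective there is nothing to remove.
  deduplicate-unique : (_≟_ : DecidableEquality A) {xs : List A} → Unique xs →
                       deduplicate _≟_ xs ≡ xs
  deduplicate-unique _≟_ {[]}     []         = refl
  deduplicate-unique _≟_ {x ∷ xs} (x≢ ∷ xs!)
    rewrite deduplicate-unique _≟_ xs! = cong (x ∷_) (List.filter-all (¬? ∘ (x ≟_)) x≢)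

-- Counting with sums of natural numbers

module Counting where

  open BigSum ℕ.+-0-isCommutativeMonoid public

  sum-map≡∑ : {A : Set} (f : A → ℕ) (xs : List A) → ℕ.sum (map f xs) ≡ ∑ xs f
  sum-map≡∑ f []       = refl
  sum-map≡∑ f (x ∷ xs) = cong (f x +_) (sum-map≡∑ f xs)

  *-distribˡ-∑ : {A : Set} (k : ℕ) (xs : List A) (f : A → ℕ) → k * ∑ xs f ≡ ∑ xs (λ x → k * f x)
  *-distribˡ-∑ k = BigSumHom.∑-hom ℕ.+-0-isCommutativeMonoid ℕ.+-0-isCommutativeMonoid
    (k *_) (ℕ.*-zeroʳ k) (ℕ.*-distribˡ-+ k)

  *-distribʳ-∑ : {A : Set} (k : ℕ) (xs : List A) (f : A → ℕ) → ∑ xs f * k ≡ ∑ xs (λ x → f x * k)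
  *-distribʳ-∑ k = BigSumHom.∑-hom ℕ.+-0-isCommutativeMonoid ℕ.+-0-isCommutativeMonoid
    (_* k) refl (ℕ.*-distribʳ-+ k)

  𝟙 : Bool → ℕ
  𝟙 b = if b then 1 else 0

  δ : ℕ → ℕ → ℕ
  δ w v = 𝟙 (does (v ℕ.≟ w))

  length-filter≡∑ : {A : Set} {P : A → Set} (P? : Decidable P) (xs : List A) →
                    length (filter P? xs) ≡ ∑ xs (λ x → 𝟙 (does (P? x)))
  length-filter≡∑ P? []       = refl
  length-filter≡∑ P? (x ∷ xs) with does (P? x)
  ... | true  = cong suc (length-filter≡∑ P? xs)
  ... | false = length-filter≡∑ P? xs

  -- The multinomial expansion

  -- Pascal's rule tested against an arbitrary `f`; the last term of the second sum drops out
  -- because `b C suc b` is 0.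
  ∑-C-suc : ∀ b (f : ℕ → ℕ) → ∑ (upTo (2 + b)) (λ i → (suc b C i) * f i)
                  ≡ ∑ (upTo (1 + b)) (λ i → (b C i) * f (suc i)) + ∑ (upTo (1 + b)) (λ i → (b C i) * f i)
  ∑-C-suc b f = begin
    ∑ (upTo (2 + b)) (λ i → (suc b C i) * f i)
      ≡⟨ ∑-upTo-suc (suc b) (λ i → (suc b C i) * f i) ⟩
    1 * f 0 + ∑ (upTo (1 + b)) (λ i → (suc b C suc i) * f (suc i))
      ≡⟨ cong (1 * f 0 +_) (∑-cong (upTo (1 + b)) λ i _ → ≡.trans
           (cong (_* f (suc i)) (sym (nCk+nC[k+1]≡[n+1]C[k+1] b i)))
           (ℕ.*-distribʳ-+ (f (suc i)) (b C i) (b C suc i))) ⟩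
    1 * f 0 + ∑ (upTo (1 + b)) (λ i → (b C i) * f (suc i) + (b C suc i) * f (suc i))
      ≡⟨ cong (1 * f 0 +_) (∑-∙ (upTo (1 + b)) (λ i → (b C i) * f (suc i)) (λ i → (b C suc i) * f (suc i))) ⟩
    1 * f 0 + (X + ∑ (upTo (1 + b)) (λ i → (b C suc i) * f (suc i)))
      ≡⟨ shuffle (1 * f 0) X _ ⟩
    X + (1 * f 0 + ∑ (upTo (1 + b)) (λ i → (b C suc i) * f (suc i)))
      ≡⟨ cong (X +_) (∑-upTo-suc (suc b) (λ i → (b C i) * f i)) ⟨
    X + ∑ (upTo (2 + b)) (λ i → (b C i) * f i)
      ≡⟨ cong (X +_) (∑-upTo-∷ʳ (suc b) (λ i → (b C i) * f i)) ⟩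
    X + (Y + (b C suc b) * f (suc b))
      ≡⟨ cong (λ z → X + (Y + z * f (suc b))) (k>n⇒nCk≡0 (ℕ.n<1+n b)) ⟩
    X + (Y + 0)
      ≡⟨ cong (X +_) (ℕ.+-identityʳ Y) ⟩
    X + Y ∎
    where
    open ≡.≡-Reasoning
    X = ∑ (upTo (1 + b)) (λ i → (b C i) * f (suc i))
    Y = ∑ (upTo (1 + b)) (λ i → (b C i) * f i)
    shuffle : ∀ x y z → x + (y + z) ≡ y + (x + z)
    shuffle = solve-∀

  -- With (w , m) read as the monomial m X^w and G as the linear functional X^v ↦ G v,
  -- this is G applied to the b-th power of the sum of the monomials.
  expand : List (ℕ × ℕ) → ℕ → (ℕ → ℕ) → ℕ
  expand []             zero    G = G 0
  expand []             (suc b) G = 0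
  expand ((w , m) ∷ ps) b       G =
    ∑ (upTo (suc b)) (λ i → (b C i) * (m ^ i * expand ps (b ∸ i) (λ v → G (i * w + v))))

  expand-cong : ∀ ps b {G H} → (∀ v → G v ≡ H v) → expand ps b G ≡ expand ps b H
  expand-cong []             zero    G≗H = G≗H 0
  expand-cong []             (suc b) G≗H = refl
  expand-cong ((w , m) ∷ ps) b       G≗H = ∑-cong (upTo (suc b)) λ i _ →
    cong (λ z → (b C i) * (m ^ i * z)) (expand-cong ps (b ∸ i) λ v → G≗H (i * w + v))

  expand-zero : ∀ ps G → expand ps 0 G ≡ G 0
  expand-zero []             G = refl
  expand-zero ((w , m) ∷ ps) G = begin
    1 * (1 * expand ps 0 G) + 0  ≡⟨ cong (λ z → 1 * (1 * z) + 0) (expand-zero ps G) ⟩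
    1 * (1 * G 0) + 0            ≡⟨ units (G 0) ⟩
    G 0                          ∎
    where
    open ≡.≡-Reasoning
    units : ∀ x → 1 * (1 * x) + 0 ≡ x
    units = solve-∀

  -- In terms of polynomials, P^(b+1) = P · P^b with the first factor P written out as a sum of
  -- monomials. Pascal's rule separates the terms whose extra factor is the head monomial (`first`)
  -- from those where it comes from the tail (`second`, by induction).
  expand-suc : ∀ ps b G →
    expand ps (suc b) G ≡ ∑ ps (λ (w , m) → m * expand ps b (λ v → G (w + v)))
  expand-suc []             b G = refl
  expand-suc ((w , m) ∷ ps) b G = begin
    ∑ (upTo (2 + b)) (λ i → (suc b C i) * f i)
      ≡⟨ ∑-C-suc b f ⟩
    ∑ (upTo (1 + b)) (λ i → (b C i) * f (suc i)) + ∑ (upTo (1 + b)) (λ i → (b C i) * f i)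
      ≡⟨ cong₂ _+_ first second ⟩
    m * expand ((w , m) ∷ ps) b (λ v → G (w + v))
      + ∑ ps (λ (w′ , m′) → m′ * expand ((w , m) ∷ ps) b (λ v → G (w′ + v))) ∎
    where
    open ≡.≡-Reasoning
    f : ℕ → ℕ
    f i = m ^ i * expand ps (suc b ∸ i) (λ v → G (i * w + v))

    pull : ∀ x y z u → x * (y * z * u) ≡ y * (x * (z * u))
    pull = solve-∀

    first : ∑ (upTo (1 + b)) (λ i → (b C i) * f (suc i))
          ≡ m * expand ((w , m) ∷ ps) b (λ v → G (w + v))
    first = begin
      ∑ (upTo (1 + b)) (λ i → (b C i) * f (suc i))
        ≡⟨ ∑-cong (upTo (1 + b)) (λ i _ → ≡.trans
             (pull (b C i) m (m ^ i) _)
             (cong (λ z → m * ((b C i) * (m ^ i * z)))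
               (expand-cong ps (b ∸ i) λ v → cong G (ℕ.+-assoc w (i * w) v)))) ⟩
      ∑ (upTo (1 + b)) (λ i → m * ((b C i) * (m ^ i * expand ps (b ∸ i) (λ v → G (w + (i * w + v))))))
        ≡⟨ *-distribˡ-∑ m (upTo (1 + b)) _ ⟨
      m * expand ((w , m) ∷ ps) b (λ v → G (w + v)) ∎

    reorder : ∀ x y z → x + (y + z) ≡ y + (x + z)
    reorder = solve-∀

    pull′ : ∀ x y z u → x * (y * (z * u)) ≡ z * (x * (y * u))
    pull′ = solve-∀

    term : ∀ i → i ∈ upTo (1 + b) → (b C i) * f i
         ≡ ∑ ps (λ (w′ , m′) → m′ * ((b C i) * (m ^ i * expand ps (b ∸ i) (λ v → G (w′ + (i * w + v))))))
    term i i∈ = begin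
      (b C i) * (m ^ i * expand ps (suc b ∸ i) (λ v → G (i * w + v)))
        ≡⟨ cong (λ d → (b C i) * (m ^ i * expand ps d (λ v → G (i * w + v))))
             (ℕ.+-∸-assoc 1 (ℕ.≤-pred (∈-upTo⁻ i∈))) ⟩
      (b C i) * (m ^ i * expand ps (suc (b ∸ i)) (λ v → G (i * w + v)))
        ≡⟨ cong (λ z → (b C i) * (m ^ i * z)) (expand-suc ps (b ∸ i) _) ⟩
      (b C i) * (m ^ i * ∑ ps (λ (w′ , m′) → m′ * expand ps (b ∸ i) (λ v → G (i * w + (w′ + v)))))
        ≡⟨ cong ((b C i) *_) (*-distribˡ-∑ (m ^ i) ps _) ⟩
      (b C i) * ∑ ps (λ (w′ , m′) → m ^ i * (m′ * expand ps (b ∸ i) (λ v → G (i * w + (w′ + v)))))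
        ≡⟨ *-distribˡ-∑ (b C i) ps _ ⟩
      ∑ ps (λ (w′ , m′) → (b C i) * (m ^ i * (m′ * expand ps (b ∸ i) (λ v → G (i * w + (w′ + v))))))
        ≡⟨ ∑-cong ps (λ (w′ , m′) _ → ≡.trans
             (pull′ (b C i) (m ^ i) m′ _)
             (cong (λ z → m′ * ((b C i) * (m ^ i * z)))
               (expand-cong ps (b ∸ i) λ v → cong G (reorder (i * w) w′ v)))) ⟩
      ∑ ps (λ (w′ , m′) → m′ * ((b C i) * (m ^ i * expand ps (b ∸ i) (λ v → G (w′ + (i * w + v)))))) ∎

    second : ∑ (upTo (1 + b)) (λ i → (b C i) * f i)
           ≡ ∑ ps (λ (w′ , m′) → m′ * expand ((w , m) ∷ ps) b (λ v → G (w′ + v)))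
    second = begin
      ∑ (upTo (1 + b)) (λ i → (b C i) * f i)
        ≡⟨ ∑-cong (upTo (1 + b)) term ⟩
      ∑ (upTo (1 + b)) (λ i → ∑ ps (λ (w′ , m′) →
        m′ * ((b C i) * (m ^ i * expand ps (b ∸ i) (λ v → G (w′ + (i * w + v)))))))
        ≡⟨ ∑-swap (upTo (1 + b)) ps _ ⟩
      ∑ ps (λ (w′ , m′) → ∑ (upTo (1 + b)) (λ i →
        m′ * ((b C i) * (m ^ i * expand ps (b ∸ i) (λ v → G (w′ + (i * w + v)))))))
        ≡⟨ ∑-cong ps (λ (w′ , m′) _ → sym (*-distribˡ-∑ m′ (upTo (1 + b)) _)) ⟩
      ∑ ps (λ (w′ , m′) → m′ * expand ((w , m) ∷ ps) b (λ v → G (w′ + v))) ∎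

  tuples : {A : Set} → List A → (b : ℕ) → List (Vec A b)
  tuples xs zero    = [ [] ]
  tuples xs (suc b) = concatMap (λ x → map (x ∷_) (tuples xs b)) xs

  length-tuples : {A : Set} (xs : List A) (b : ℕ) → length (tuples xs b) ≡ length xs ^ b
  length-tuples xs zero    = refl
  length-tuples {A} xs (suc b) = go xs
    where
    go : (ys : List A) → length (concatMap (λ x → map (x ∷_) (tuples xs b)) ys) ≡ length ys * length xs ^ b
    go []       = refl
    go (y ∷ ys) = ≡.trans (List.length-++ (map (y ∷_) (tuples xs b)))
      (cong₂ _+_ (≡.trans (List.length-map (y ∷_) (tuples xs b)) (length-tuples xs b)) (go ys))

  ∈-tuples : {A : Set} {xs : List A} → (∀ x → x ∈ xs) → ∀ {b} (t : Vec A b) → t ∈ tuples xs b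
  ∈-tuples         all []      = here refl
  ∈-tuples {xs = xs} all (x ∷ t) =
    ∈-concatMap⁺ (λ x → map (x ∷_) (tuples xs _)) (lose (all x) (∈-map⁺ (x ∷_) (∈-tuples all t)))

  -- The weight enumerator of a b-fold product is the b-th power of the enumerator of one factor:
  -- the hypothesis says that `ps` is the distribution of `W` on `xs`, and each entry of the tuple
  -- contributes one factor through `expand-suc`.
  ∑-tuples : {A : Set} (xs : List A) (W : A → ℕ) (ps : List (ℕ × ℕ)) →
    (∀ f → ∑ xs (f ∘ W) ≡ ∑ ps (λ (w , m) → m * f w)) →
    ∀ b G → ∑ (tuples xs b) (λ t → G (Vec.sum (Vec.map W t))) ≡ expand ps b G
  ∑-tuples xs W ps classes zero    G = ≡.trans (ℕ.+-identityʳ (G 0)) (sym (expand-zero ps G))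
  ∑-tuples xs W ps classes (suc b) G = begin
    ∑ (tuples xs (suc b)) (λ t → G (Vec.sum (Vec.map W t)))
      ≡⟨ ∑-concatMap _ xs _ ⟩
    ∑ xs (λ x → ∑ (map (x ∷_) (tuples xs b)) (λ t → G (Vec.sum (Vec.map W t))))
      ≡⟨ ∑-cong xs (λ x _ → ≡.trans (∑-map (x ∷_) (tuples xs b) _)
           (∑-tuples xs W ps classes b (λ v → G (W x + v)))) ⟩
    ∑ xs (λ x → expand ps b (λ v → G (W x + v)))
      ≡⟨ classes (λ w → expand ps b (λ v → G (w + v))) ⟩
    ∑ ps (λ (w , m) → m * expand ps b (λ v → G (w + v)))
      ≡⟨ expand-suc ps b G ⟨
    expand ps (suc b) G ∎
    where open ≡.≡-Reasoning

  -- Needed because `multinomial` recovers the total from the entries of the vector, whereas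
  -- `expand` carries it along as `b`.
  sum-compositions : ∀ s b (ℓ : Vec ℕ s) → ℓ ∈ compositions s b → Vec.sum ℓ ≡ b
  sum-compositions zero    zero    [] _ = refl
  sum-compositions (suc s) b ℓ ℓ∈
    with find (∈-concatMap⁻ (λ i → map (i ∷_) (compositions s (b ∸ i))) {xs = upTo (suc b)} ℓ∈)
  ... | i , i∈ , ℓ∈′ with ∈-map⁻ (i ∷_) ℓ∈′
  ...   | ℓ′ , ℓ′∈ , refl =
    ≡.trans (cong (i +_) (sum-compositions s (b ∸ i) ℓ′ ℓ′∈)) (ℕ.m+[n∸m]≡n (ℕ.≤-pred (∈-upTo⁻ i∈)))

  -- `ℓ` records how often each monomial is chosen, and the nested binomial coefficients of `expand`
  -- multiply up to the multinomial coefficient.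
  expand-compositions : ∀ {s} (ws ms : Vec ℕ s) b G →
    expand (Vec.toList (Vec.zip ws ms)) b G
      ≡ ∑ (compositions s b) (λ ℓ → multinomial ℓ * Vec.foldr _ _*_ 1 (Vec.zipWith _^_ ms ℓ)
                                  * G (Vec.sum (Vec.zipWith _*_ ℓ ws)))
  expand-compositions []       []       zero    G = sym (≡.trans (ℕ.+-identityʳ (1 * G 0)) (ℕ.*-identityˡ (G 0)))
  expand-compositions []       []       (suc b) G = refl
  expand-compositions {suc s} (w ∷ ws) (m ∷ ms) b G = begin
    ∑ (upTo (suc b)) (λ i → (b C i) * (m ^ i * expand (Vec.toList (Vec.zip ws ms)) (b ∸ i) (λ v → G (i * w + v))))
      ≡⟨ ∑-cong (upTo (suc b)) (λ i i∈ → term i (ℕ.≤-pred (∈-upTo⁻ i∈))) ⟩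
    ∑ (upTo (suc b)) (λ i → ∑ (map (i ∷_) (compositions s (b ∸ i))) (T (w ∷ ws) (m ∷ ms) G))
      ≡⟨ ∑-concatMap (λ i → map (i ∷_) (compositions s (b ∸ i))) (upTo (suc b)) _ ⟨
    ∑ (compositions (suc s) b) (T (w ∷ ws) (m ∷ ms) G) ∎
    where
    open ≡.≡-Reasoning
    T : ∀ {s} (ws ms : Vec ℕ s) (G : ℕ → ℕ) → Vec ℕ s → ℕ
    T ws ms G ℓ = multinomial ℓ * Vec.foldr _ _*_ 1 (Vec.zipWith _^_ ms ℓ)
                * G (Vec.sum (Vec.zipWith _*_ ℓ ws))

    regroup : ∀ c x M P g → c * (x * (M * P * g)) ≡ c * M * (x * P) * g
    regroup = solve-∀

    term : ∀ i → i ≤ b →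
      (b C i) * (m ^ i * expand (Vec.toList (Vec.zip ws ms)) (b ∸ i) (λ v → G (i * w + v)))
      ≡ ∑ (map (i ∷_) (compositions s (b ∸ i))) (T (w ∷ ws) (m ∷ ms) G)
    term i i≤b = begin
      (b C i) * (m ^ i * expand (Vec.toList (Vec.zip ws ms)) (b ∸ i) (λ v → G (i * w + v)))
        ≡⟨ cong (λ z → (b C i) * (m ^ i * z)) (expand-compositions ws ms (b ∸ i) _) ⟩
      (b C i) * (m ^ i * ∑ (compositions s (b ∸ i)) (T ws ms (λ v → G (i * w + v))))
        ≡⟨ cong ((b C i) *_) (*-distribˡ-∑ (m ^ i) (compositions s (b ∸ i)) _) ⟩
      (b C i) * ∑ (compositions s (b ∸ i)) (λ ℓ → m ^ i * T ws ms (λ v → G (i * w + v)) ℓ)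
        ≡⟨ *-distribˡ-∑ (b C i) (compositions s (b ∸ i)) _ ⟩
      ∑ (compositions s (b ∸ i)) (λ ℓ → (b C i) * (m ^ i * T ws ms (λ v → G (i * w + v)) ℓ))
        ≡⟨ ∑-cong (compositions s (b ∸ i)) (λ ℓ ℓ∈ → ≡.trans
             (cong (λ d → (d C i) * (m ^ i * T ws ms (λ v → G (i * w + v)) ℓ))
               (sym (≡.trans (cong (i +_) (sum-compositions s (b ∸ i) ℓ ℓ∈)) (ℕ.m+[n∸m]≡n i≤b))))
             (regroup ((i + Vec.sum ℓ) C i) (m ^ i) (multinomial ℓ) _ _)) ⟩
      ∑ (compositions s (b ∸ i)) (λ ℓ → T (w ∷ ws) (m ∷ ms) G (i ∷ ℓ))
        ≡⟨ ∑-map (i ∷_) (compositions s (b ∸ i)) _ ⟨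
      ∑ (map (i ∷_) (compositions s (b ∸ i))) (T (w ∷ ws) (m ∷ ms) G) ∎

  predictedFreq≡expand : ∀ {s} b (ws ms : Vec ℕ s) w →
    predictedFreq b ws ms w ≡ expand (Vec.toList (Vec.zip ws ms)) b (δ w)
  predictedFreq≡expand {s} b ws ms w = ≡.trans (sum-map≡∑ _ (compositions s b)) (≡.trans
    (∑-cong (compositions s b) λ ℓ _ →
      if-* (does (Vec.sum (Vec.zipWith _*_ ℓ ws) ℕ.≟ w)) (multinomial ℓ * Vec.foldr _ _*_ 1 (Vec.zipWith _^_ ms ℓ)))
    (sym (expand-compositions ws ms b (δ w))))
    where
    if-* : ∀ c x → (if c then x else 0) ≡ x * 𝟙 c
    if-* true  x = sym (ℕ.*-identityʳ x)
    if-* false x = sym (ℕ.*-zeroʳ x)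

  𝟙-¬?-cong : {P Q : Set} (P? : Dec P) (Q? : Dec Q) → (P → Q) → (Q → P) → 𝟙 (does (¬? P?)) ≡ 𝟙 (does (¬? Q?))
  𝟙-¬?-cong (yes _) (yes _) _   _   = refl
  𝟙-¬?-cong (no _)  (no _)  _   _   = refl
  𝟙-¬?-cong (yes p) (no ¬q) p⇒q _   = contradiction (p⇒q p) ¬q
  𝟙-¬?-cong (no ¬p) (yes q) _   q⇒p = contradiction (q⇒p q) ¬p

  δ-refl : ∀ w → δ w w ≡ 1
  δ-refl w = cong 𝟙 (dec-true (w ℕ.≟ w) refl)

  δ-≢ : ∀ {w v} → w ≢ v → δ w v ≡ 0
  δ-≢ {w} {v} w≢v = cong 𝟙 (dec-false (v ℕ.≟ w) (w≢v ∘ sym))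

  ∑-δ-∉ : ∀ {s} (ws : Vec ℕ s) v (f : ℕ → ℕ) → (∀ i → Vec.lookup ws i ≢ v) → ∑ (Vec.toList ws) (λ w → δ w v * f w) ≡ 0
  ∑-δ-∉ []       v f ∉ws = refl
  ∑-δ-∉ (w ∷ ws) v f ∉ws = cong₂ _+_ (cong (_* f w) (δ-≢ (∉ws Fin.zero))) (∑-δ-∉ ws v f (∉ws ∘ Fin.suc))

  ∑-δ : ∀ {s} (ws : Vec ℕ s) → (∀ i j → Vec.lookup ws i ≡ Vec.lookup ws j → i ≡ j) →
        ∀ i (f : ℕ → ℕ) → ∑ (Vec.toList ws) (λ w → δ w (Vec.lookup ws i) * f w) ≡ f (Vec.lookup ws i)
  ∑-δ (w ∷ ws) inj Fin.zero    f = begin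
    δ w w * f w + ∑ (Vec.toList ws) (λ w′ → δ w′ w * f w′)
      ≡⟨ cong₂ _+_ (cong (_* f w) (δ-refl w)) (∑-δ-∉ ws w f λ i eq → contradiction (inj (Fin.suc i) Fin.zero eq) λ ()) ⟩
    1 * f w + 0
      ≡⟨ ≡.trans (ℕ.+-identityʳ (1 * f w)) (ℕ.*-identityˡ (f w)) ⟩
    f w ∎
    where open ≡.≡-Reasoning
  ∑-δ (w ∷ ws) inj (Fin.suc i) f = cong₂ _+_
    (cong (_* f w) (δ-≢ λ eq → contradiction (inj Fin.zero (Fin.suc i) eq) λ ()))
    (∑-δ ws (λ i j eq → Fin.suc-injective (inj (Fin.suc i) (Fin.suc j) eq)) i f)

  -- Every value of `W` occurs exactly once in `ws`, so the sum of `δ w (W x)` over `ws` is 1;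
  -- inserting it and exchanging the two sums groups the `x` by value.
  ∑-by-value : {A : Set} (xs : List A) (W : A → ℕ) {s : ℕ} (ws : Vec ℕ s) →
    (∀ i j → Vec.lookup ws i ≡ Vec.lookup ws j → i ≡ j) → (∀ x → ∃ λ i → Vec.lookup ws i ≡ W x) →
    ∀ (f : ℕ → ℕ) → ∑ xs (f ∘ W) ≡ ∑ (Vec.toList (Vec.zip ws (Vec.map (λ w → ∑ xs (λ x → δ w (W x))) ws))) (λ (w , m) → m * f w)
  ∑-by-value xs W ws inj values f = sym (begin
    ∑ (Vec.toList (Vec.zip ws (Vec.map frequency ws))) (λ (w , m) → m * f w)
      ≡⟨ unzip ws ⟩
    ∑ (Vec.toList ws) (λ w → frequency w * f w)
      ≡⟨ ∑-cong (Vec.toList ws) (λ w _ → *-distribʳ-∑ (f w) xs (λ x → δ w (W x))) ⟩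
    ∑ (Vec.toList ws) (λ w → ∑ xs (λ x → δ w (W x) * f w))
      ≡⟨ ∑-swap (Vec.toList ws) xs (λ w x → δ w (W x) * f w) ⟩
    ∑ xs (λ x → ∑ (Vec.toList ws) (λ w → δ w (W x) * f w))
      ≡⟨ ∑-cong xs (λ x _ → let i , eq = values x in
           subst (λ v → ∑ (Vec.toList ws) (λ w → δ w v * f w) ≡ f v) eq (∑-δ ws inj i f)) ⟩
    ∑ xs (f ∘ W) ∎)
    where
    open ≡.≡-Reasoning
    frequency : ℕ → ℕ
    frequency w = ∑ xs (λ x → δ w (W x))
    unzip : ∀ {s} (ws : Vec ℕ s) →
      ∑ (Vec.toList (Vec.zip ws (Vec.map frequency ws))) (λ (w , m) → m * f w) ≡ ∑ (Vec.toList ws) (λ w → frequency w * f w)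
    unzip []       = refl
    unzip (w ∷ ws) = cong (frequency w * f w +_) (unzip ws)

  sum-map-tabulate : {A : Set} (f : A → ℕ) (x : ℕ → A) (n : ℕ) →
    Vec.sum (Vec.map f (Vec.tabulate {n = n} (x ∘ toℕ))) ≡ ∑ (upTo n) (f ∘ x)
  sum-map-tabulate f x zero    = refl
  sum-map-tabulate f x (suc n) =
    ≡.trans (cong (f (x 0) +_) (sum-map-tabulate f (x ∘ suc) n)) (sym (∑-upTo-suc n (f ∘ x)))

  toList-tabulate : {A : Set} (x : ℕ → A) (n : ℕ) → Vec.toList (Vec.tabulate {n = n} (x ∘ toℕ)) ≡ map x (upTo n)
  toList-tabulate x n = ≡.trans (go x n) (sym (List.map-upTo x n))
    where
    go : {A : Set} (x : ℕ → A) (n : ℕ) → Vec.toList (Vec.tabulate {n = n} (x ∘ toℕ)) ≡ applyUpTo x n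
    go x zero    = refl
    go x (suc n) = cong (x 0 ∷_) (go (x ∘ suc) n)

tabulate-toℕ-injective : {A : Set} {n : ℕ} (x y : ℕ → A) → Vec.tabulate {n = n} (x ∘ toℕ) ≡ Vec.tabulate (y ∘ toℕ) →
                         ∀ i → i < n → x i ≡ y i
tabulate-toℕ-injective x y eq i i<n = begin
  x i                                           ≡⟨ cong x (Fin.toℕ-fromℕ< i<n) ⟨
  x (toℕ (Fin.fromℕ< i<n))                      ≡⟨ Vec.lookup∘tabulate (x ∘ toℕ) (Fin.fromℕ< i<n) ⟨
  Vec.lookup (Vec.tabulate (x ∘ toℕ)) (Fin.fromℕ< i<n)  ≡⟨ cong (λ v → Vec.lookup v (Fin.fromℕ< i<n)) eq ⟩
  Vec.lookup (Vec.tabulate (y ∘ toℕ)) (Fin.fromℕ< i<n)  ≡⟨ Vec.lookup∘tabulate (y ∘ toℕ) (Fin.fromℕ< i<n) ⟩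
  y (toℕ (Fin.fromℕ< i<n))                      ≡⟨ cong y (Fin.toℕ-fromℕ< i<n) ⟩
  y i                                           ∎
  where open ≡.≡-Reasoning

-- Binomial coefficients modulo a prime

prime∤! : ∀ {p} → Prime p → ∀ k → k < p → ¬ (p ∣ k !)
prime∤! pr zero    k<p p∣1 = ℕ.nonTrivial⇒≢1 {{prime⇒nonTrivial pr}} (∣1⇒≡1 p∣1)
prime∤! pr (suc k) k<p p∣  with euclidsLemma (suc k) (k !) pr p∣
... | inj₁ p∣k+1 = ℕ.<⇒≱ k<p (∣⇒≤ p∣k+1)
... | inj₂ p∣k!  = prime∤! pr k (ℕ.<-trans (ℕ.n<1+n k) k<p) p∣k!

-- p divides p! = C · k! · (p - k)!, but neither of the two factorials, as 0 < k < p.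
prime∣C : ∀ {p} → Prime p → ∀ k → 0 < k → k < p → p ∣ p C k
prime∣C {p} pr k 0<k k<p with euclidsLemma (p C k) (k ! * (p ∸ k) !) pr p∣C*k![p-k]!
  where
  instance
    _ : NonZero (k ! * (p ∸ k) !)
    _ = ℕ._!*_!≢0 k (p ∸ k)
  C*k![p-k]!≡p! : (p C k) * (k ! * (p ∸ k) !) ≡ p !
  C*k![p-k]!≡p! = ≡.trans (cong (_* (k ! * (p ∸ k) !)) (nCk≡n!/k![n-k]! (ℕ.<⇒≤ k<p)))
    (m/n*n≡m (k![n∸k]!∣n! (ℕ.<⇒≤ k<p)))
  p∣p! : ∀ p → 0 < p → p ∣ p !
  p∣p! (suc q) _ = m∣m*n (q !)
  p∣C*k![p-k]! : p ∣ (p C k) * (k ! * (p ∸ k) !)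
  p∣C*k![p-k]! = subst (p ∣_) (sym C*k![p-k]!≡p!) (p∣p! p (ℕ.<-trans 0<k k<p))
... | inj₁ p∣C = p∣C
... | inj₂ p∣  with euclidsLemma (k !) ((p ∸ k) !) pr p∣
...   | inj₁ p∣k!     = contradiction p∣k! (prime∤! pr k k<p)
...   | inj₂ p∣[p-k]! = contradiction p∣[p-k]!
  (prime∤! pr (p ∸ k) (ℕ.∸-monoʳ-< 0<k (ℕ.<⇒≤ k<p)))

-- Finite fields

module Field (F : FiniteField) where
  open FiniteField F

  commutativeRing : CommutativeRing 0ℓ 0ℓ
  commutativeRing = record { isCommutativeRing = isCommutativeRing }

  open CommutativeRing commutativeRing public
    using (+-assoc; +-comm; +-identityˡ; +-identityʳ; -‿inverseˡ; -‿inverseʳ; *-assoc; *-comm; *-identityˡ; *-identityʳ;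
           distribˡ; distribʳ; zeroˡ; zeroʳ; +-isCommutativeMonoid; +-group; ring; semiring; commutativeSemiring)
  open Algebra.Properties.Group +-group public
    using (∙-cancelˡ; x∙y⁻¹≈ε⇒x≈y; x≈y⇒x∙y⁻¹≈ε; inverseʳ-unique; ε⁻¹≈ε)
  open Algebra.Properties.Ring ring public using (-‿distribˡ-*; -1*x≈-x)
  open Algebra.Properties.Semiring.Mult semiring public
    using (×-homo-+; ×1-homo-*; ×-assoc-*; ×-assocˡ) renaming (_×_ to _·_)
  open BigSum +-isCommutativeMonoid public
  open Algebra.Solver.Ring.NaturalCoefficients.Default commutativeSemiring using (solve; _:=_; _:+_; _:*_; con)
  open ≡.≡-Reasoning

  fsum-map≡∑ : {B : Set} (f : B → Carrier) (xs : List B) → fsum (map f xs) ≡ ∑ xs f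
  fsum-map≡∑ f []       = refl
  fsum-map≡∑ f (x ∷ xs) = cong (f x ⊕_) (fsum-map≡∑ f xs)

  ⊗-distribˡ-∑ : {B : Set} (y : Carrier) (xs : List B) (f : B → Carrier) → y ⊗ ∑ xs f ≡ ∑ xs (λ x → y ⊗ f x)
  ⊗-distribˡ-∑ y = BigSumHom.∑-hom +-isCommutativeMonoid +-isCommutativeMonoid (y ⊗_) (zeroʳ y) (distribˡ y)

  pow-+ : ∀ x i j → pow x (i + j) ≡ pow x i ⊗ pow x j
  pow-+ x zero    j = sym (*-identityˡ _)
  pow-+ x (suc i) j = ≡.trans (cong (x ⊗_) (pow-+ x i j)) (sym (*-assoc _ _ _))

  pow-* : ∀ x i j → pow x (i * j) ≡ pow (pow x i) j
  pow-* x i zero    = cong (pow x) (ℕ.*-zeroʳ i)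
  pow-* x i (suc j) = ≡.trans (cong (pow x) (ℕ.*-suc i j))
    (≡.trans (pow-+ x i (i * j)) (cong (pow x i ⊗_) (pow-* x i j)))

  pow-⊗ : ∀ x y n → pow (x ⊗ y) n ≡ pow x n ⊗ pow y n
  pow-⊗ x y zero    = sym (*-identityˡ 1#)
  pow-⊗ x y (suc n) = ≡.trans (cong ((x ⊗ y) ⊗_) (pow-⊗ x y n))
    (solve 4 (λ x y u v → (x :* y) :* (u :* v) := (x :* u) :* (y :* v)) refl x y (pow x n) (pow y n))

  pow-comm : ∀ x i j → pow (pow x i) j ≡ pow (pow x j) i
  pow-comm x i j = ≡.trans (sym (pow-* x i j)) (≡.trans (cong (pow x) (ℕ.*-comm i j)) (pow-* x j i))

  pow-1# : ∀ n → pow 1# n ≡ 1#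
  pow-1# zero    = refl
  pow-1# (suc n) = ≡.trans (*-identityˡ _) (pow-1# n)

  pow-0# : ∀ n → 0 < n → pow 0# n ≡ 0#
  pow-0# (suc n) _ = zeroˡ _

  pow-1 : ∀ x → pow x 1 ≡ x
  pow-1 = *-identityʳ

  pow-% : ∀ x d .{{_ : NonZero d}} → pow x d ≡ 1# → ∀ j → pow x (j % d) ≡ pow x j
  pow-% x d x^d≡1 j = sym (begin
    pow x j                                  ≡⟨ cong (pow x) (m≡m%n+[m/n]*n j d) ⟩
    pow x (j % d + j / d * d)                ≡⟨ pow-+ x (j % d) _ ⟩
    pow x (j % d) ⊗ pow x (j / d * d)        ≡⟨ cong (λ z → pow x (j % d) ⊗ pow x z) (ℕ.*-comm (j / d) d) ⟩
    pow x (j % d) ⊗ pow x (d * (j / d))      ≡⟨ cong (pow x (j % d) ⊗_) (pow-* x d (j / d)) ⟩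
    pow x (j % d) ⊗ pow (pow x d) (j / d)    ≡⟨ cong (λ z → pow x (j % d) ⊗ pow z (j / d)) x^d≡1 ⟩
    pow x (j % d) ⊗ pow 1# (j / d)           ≡⟨ cong (pow x (j % d) ⊗_) (pow-1# (j / d)) ⟩
    pow x (j % d) ⊗ 1#                       ≡⟨ *-identityʳ _ ⟩
    pow x (j % d)                            ∎)

  ⊗-cancelˡ : ∀ x {y z} → x ≢ 0# → x ⊗ y ≡ x ⊗ z → y ≡ z
  ⊗-cancelˡ x {y} {z} x≢0 eq with inverse x x≢0
  ... | x⁻¹ , xx⁻¹≡1 = ≡.trans (sym (undo y)) (≡.trans (cong (x⁻¹ ⊗_) eq) (undo z))
    where
    undo : ∀ w → x⁻¹ ⊗ (x ⊗ w) ≡ w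
    undo w = begin
      x⁻¹ ⊗ (x ⊗ w)  ≡⟨ *-assoc x⁻¹ x w ⟨
      (x⁻¹ ⊗ x) ⊗ w  ≡⟨ cong (_⊗ w) (≡.trans (*-comm x⁻¹ x) xx⁻¹≡1) ⟩
      1# ⊗ w         ≡⟨ *-identityˡ w ⟩
      w              ∎

  x≢0∧xy≡0⇒y≡0 : ∀ {x y} → x ≢ 0# → x ⊗ y ≡ 0# → y ≡ 0#
  x≢0∧xy≡0⇒y≡0 {x} x≢0 eq = ⊗-cancelˡ x x≢0 (≡.trans eq (sym (zeroʳ x)))

  pow≢0 : ∀ {x} n → x ≢ 0# → pow x n ≢ 0#
  pow≢0 zero    x≢0 eq = 0≢1 (sym eq)
  pow≢0 (suc n) x≢0 eq = pow≢0 n x≢0 (x≢0∧xy≡0⇒y≡0 x≢0 eq)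

  elements! : Unique elements
  elements! = Unique.map⁺
    (λ {i} {j} eq → ≡.trans (sym (from-to i)) (≡.trans (cong (Inverse.from enum) eq) (from-to j)))
    (Unique.allFin⁺ size)
    where
    from-to : ∀ i → Inverse.from enum (Inverse.to enum i) ≡ i
    from-to i = Inverse.strictlyInverseʳ enum i

  ∈-elements : ∀ x → x ∈ elements
  ∈-elements x = subst (_∈ elements) (Inverse.strictlyInverseˡ enum x)
    (∈-map⁺ (Inverse.to enum) (∈-allFin (Inverse.from enum x)))

  from-injective : ∀ {x y} → Inverse.from enum x ≡ Inverse.from enum y → x ≡ y
  from-injective {x} {y} eq = ≡.trans (sym (Inverse.strictlyInverseˡ enum x))
    (≡.trans (cong (Inverse.to enum) eq) (Inverse.strictlyInverseˡ enum y))

  length-elements : length elements ≡ size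
  length-elements = ≡.trans (List.length-map (Inverse.to enum) (allFin size)) (List.length-tabulate id)

  unique⇒length≤size : ∀ {xs : List Carrier} → Unique xs → length xs ≤ size
  unique⇒length≤size xs! = subst (_ ≤_) length-elements (unique-⊆⇒length≤ xs! (λ _ → ∈-elements _))

  covers⇒size≤length : ∀ {xs : List Carrier} → (∀ x → x ∈ xs) → size ≤ length xs
  covers⇒size≤length ∈xs = subst (_≤ _) length-elements (unique-⊆⇒length≤ elements! (λ _ → ∈xs _))

  2≤size : 2 ≤ size
  2≤size = unique⇒length≤size {0# ∷ 1# ∷ []} ((0≢1 ∷ []) ∷ [] ∷ [])

  size≡1+ : size ≡ suc (size ∸ 1)
  size≡1+ = sym (ℕ.m+[n∸m]≡n (ℕ.≤-trans (s≤s z≤n) 2≤size))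

  -- Translation by 1 permutes the field, so it preserves the sum of all elements while adding 1
  -- once per element.
  size·1≡0 : size · 1# ≡ 0#
  size·1≡0 = ∙-cancelˡ (∑ elements id) _ _ (begin
    ∑ elements id ⊕ size · 1#               ≡⟨ cong (λ n → ∑ elements id ⊕ n · 1#) length-elements ⟨
    ∑ elements id ⊕ length elements · 1#    ≡⟨ cong (∑ elements id ⊕_) (∑-const elements) ⟨
    ∑ elements id ⊕ ∑ elements (λ _ → 1#)   ≡⟨ ∑-∙ elements id (λ _ → 1#) ⟨
    ∑ elements (λ x → x ⊕ 1#)               ≡⟨ ∑-map (_⊕ 1#) elements id ⟨
    ∑ (map (_⊕ 1#) elements) id             ≡⟨ ∑-↭ id translate ⟩
    ∑ elements id                           ≡⟨ +-identityʳ _ ⟨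
    ∑ elements id ⊕ 0#                      ∎)
    where
    ∑-const : ∀ (xs : List Carrier) → ∑ xs (λ _ → 1#) ≡ length xs · 1#
    ∑-const []       = refl
    ∑-const (x ∷ xs) = cong (1# ⊕_) (∑-const xs)
    translate : map (_⊕ 1#) elements ↭ elements
    translate = unique-⊆⇒↭
      (Unique.map⁺ (λ {x} {y} eq → ∙-cancelˡ 1# x y (≡.trans (+-comm 1# x) (≡.trans eq (+-comm y 1#)))) elements!)
      (λ _ → ∈-elements _) (List.length-map (_⊕ 1#) elements)

  ·-zeroʳ : ∀ n → n · 0# ≡ 0#
  ·-zeroʳ zero    = refl
  ·-zeroʳ (suc n) = ≡.trans (+-identityˡ _) (·-zeroʳ n)

  ·-as-⊗ : ∀ n x → n · x ≡ (n · 1#) ⊗ x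
  ·-as-⊗ n x = sym (≡.trans (×-assoc-* n 1# x) (cong (n ·_) (*-identityˡ x)))

  -- Multiplying the relation by x j and subtracting its shift eliminates the j-th term.
  vandermonde : {B : Set} (js : List B) (c x : B → Carrier) → Unique (map x js) →
                (∀ i → ∑ js (λ j → c j ⊗ pow (x j) i) ≡ 0#) → ∀ {j} → j ∈ js → c j ≡ 0#
  vandermonde {B} (j ∷ js) c x (xj≢ ∷ xs!) rel = λ where
      (here refl) → head≡0
      (there k∈)  → tail≡0 k∈
    where
    S : ℕ → Carrier
    S i = ∑ js (λ k → c k ⊗ pow (x k) i)

    S-suc : ∀ i → S (suc i) ≡ x j ⊗ S i
    S-suc i = ∙-cancelˡ (c j ⊗ pow (x j) (suc i)) _ _ (begin
      c j ⊗ pow (x j) (suc i) ⊕ S (suc i)     ≡⟨ rel (suc i) ⟩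
      0#                                      ≡⟨ zeroʳ (x j) ⟨
      x j ⊗ 0#                                ≡⟨ cong (x j ⊗_) (rel i) ⟨
      x j ⊗ (c j ⊗ pow (x j) i ⊕ S i)         ≡⟨ solve 4 (λ x c y s → x :* (c :* y :+ s) := c :* (x :* y) :+ x :* s)
                                                   refl (x j) (c j) (pow (x j) i) (S i) ⟩
      c j ⊗ pow (x j) (suc i) ⊕ x j ⊗ S i     ∎)

    rel′ : ∀ i → ∑ js (λ k → ((x k ⊕ ⊖ x j) ⊗ c k) ⊗ pow (x k) i) ≡ 0#
    rel′ i = begin
      ∑ js (λ k → ((x k ⊕ ⊖ x j) ⊗ c k) ⊗ pow (x k) i)
        ≡⟨ ∑-cong js (λ k _ → solve 4 (λ x y c z → ((x :+ y) :* c) :* z := c :* (x :* z) :+ y :* (c :* z))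
             refl (x k) (⊖ x j) (c k) (pow (x k) i)) ⟩
      ∑ js (λ k → c k ⊗ pow (x k) (suc i) ⊕ ⊖ x j ⊗ (c k ⊗ pow (x k) i))
        ≡⟨ ∑-∙ js _ _ ⟩
      S (suc i) ⊕ ∑ js (λ k → ⊖ x j ⊗ (c k ⊗ pow (x k) i))
        ≡⟨ cong₂ _⊕_ (S-suc i) (sym (⊗-distribˡ-∑ (⊖ x j) js _)) ⟩
      x j ⊗ S i ⊕ ⊖ x j ⊗ S i
        ≡⟨ distribʳ (S i) (x j) (⊖ x j) ⟨
      (x j ⊕ ⊖ x j) ⊗ S i
        ≡⟨ cong (_⊗ S i) (-‿inverseʳ (x j)) ⟩
      0# ⊗ S i
        ≡⟨ zeroˡ (S i) ⟩
      0# ∎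

    tail≡0 : ∀ {k} → k ∈ js → c k ≡ 0#
    tail≡0 {k} k∈ = x≢0∧xy≡0⇒y≡0
      (λ eq → All.lookup xj≢ (∈-map⁺ x k∈) (sym (x∙y⁻¹≈ε⇒x≈y (x k) (x j) eq)))
      (vandermonde js (λ k → (x k ⊕ ⊖ x j) ⊗ c k) x xs! rel′ k∈)

    head≡0 : c j ≡ 0#
    head≡0 = begin
      c j                      ≡⟨ *-identityʳ (c j) ⟨
      c j ⊗ 1#                 ≡⟨ +-identityʳ _ ⟨
      c j ⊗ 1# ⊕ 0#            ≡⟨ cong (c j ⊗ 1# ⊕_) (∑-ε js) ⟨
      c j ⊗ 1# ⊕ ∑ js (λ _ → 0#)
        ≡⟨ cong (c j ⊗ 1# ⊕_) (∑-cong js λ k k∈ → sym (≡.trans (cong (_⊗ 1#) (tail≡0 k∈)) (zeroˡ 1#))) ⟩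
      c j ⊗ 1# ⊕ S 0           ≡⟨ rel 0 ⟩
      0#                       ∎

  -- Polynomials as coefficient lists, and the number of their roots

  horner : List Carrier → Carrier → Carrier
  horner []       x = 0#
  horner (c ∷ cs) x = c ⊕ x ⊗ horner cs x

  -- The quotient of the polynomial c ∷ cs by X - r, for every c (synthetic division).
  quotient : Carrier → List Carrier → List Carrier
  quotient r []       = []
  quotient r (c ∷ cs) = horner (c ∷ cs) r ∷ quotient r cs

  length-quotient : ∀ r cs → length (quotient r cs) ≡ length cs
  length-quotient r []       = refl
  length-quotient r (c ∷ cs) = cong suc (length-quotient r cs)

  -- The argument is written `r ⊕ d` so that the factor X - r becomes `d`: the identity is then free
  -- of subtraction and within reach of a semiring solver.
  horner-quotient : ∀ r d c cs →
    horner (c ∷ cs) (r ⊕ d) ≡ horner (c ∷ cs) r ⊕ d ⊗ horner (quotient r cs) (r ⊕ d)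
  horner-quotient r d c []        =
    solve 3 (λ c r d → c :+ (r :+ d) :* con 0 := (c :+ r :* con 0) :+ d :* con 0) refl c r d
  horner-quotient r d c (c′ ∷ cs) = begin
    c ⊕ (r ⊕ d) ⊗ horner (c′ ∷ cs) (r ⊕ d)
      ≡⟨ cong (λ z → c ⊕ (r ⊕ d) ⊗ z) (horner-quotient r d c′ cs) ⟩
    c ⊕ (r ⊕ d) ⊗ (horner (c′ ∷ cs) r ⊕ d ⊗ horner (quotient r cs) (r ⊕ d))
      ≡⟨ solve 5 (λ c r d h q → c :+ (r :+ d) :* (h :+ d :* q) := (c :+ r :* h) :+ d :* (h :+ (r :+ d) :* q))
           refl c r d (horner (c′ ∷ cs) r) (horner (quotient r cs) (r ⊕ d)) ⟩
    (c ⊕ r ⊗ horner (c′ ∷ cs) r) ⊕ d ⊗ (horner (c′ ∷ cs) r ⊕ (r ⊕ d) ⊗ horner (quotient r cs) (r ⊕ d)) ∎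

  horner-zero : ∀ {cs} x → All (_≡ 0#) cs → horner cs x ≡ 0#
  horner-zero x []           = refl
  horner-zero x (refl ∷ cs≡) =
    ≡.trans (+-identityˡ _) (≡.trans (cong (x ⊗_) (horner-zero x cs≡)) (zeroʳ x))

  -- `quotient r (c ∷ cs)` lists the remainder at `r` followed by the coefficients of the quotient,
  -- and the two together determine the polynomial.
  quotient-zero : ∀ r cs → All (_≡ 0#) (quotient r cs) → All (_≡ 0#) cs
  quotient-zero r []       []           = []
  quotient-zero r (c ∷ cs) (h≡0 ∷ qs≡0) = c≡0 ∷ cs≡0
    where
    cs≡0 : All (_≡ 0#) cs
    cs≡0 = quotient-zero r cs qs≡0
    c≡0 : c ≡ 0#
    c≡0 = begin
      c                      ≡⟨ +-identityʳ c ⟨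
      c ⊕ 0#                 ≡⟨ cong (c ⊕_) (zeroʳ r) ⟨
      c ⊕ r ⊗ 0#             ≡⟨ cong (λ z → c ⊕ r ⊗ z) (horner-zero r cs≡0) ⟨
      c ⊕ r ⊗ horner cs r    ≡⟨ h≡0 ⟩
      0#                     ∎

  -- The degree is below `length cs`, so that many distinct roots already suffice. Each root is
  -- divided out; the others remain roots of the quotient because a field has no zero divisors.
  too-many-roots : ∀ cs rs → Unique rs → length cs ≤ length rs →
                   (∀ {r} → r ∈ rs → horner cs r ≡ 0#) → All (_≡ 0#) cs
  too-many-roots []       rs       _          _        _    = []
  too-many-roots (c ∷ cs) (r ∷ rs) (r≢ ∷ rs!) (s≤s le) root =
    quotient-zero r (c ∷ cs) (root (here refl) ∷
      too-many-roots (quotient r cs) rs rs! (subst (_≤ length rs) (sym (length-quotient r cs)) le) root′)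
    where
    root′ : ∀ {s} → s ∈ rs → horner (quotient r cs) s ≡ 0#
    root′ {s} s∈ = x≢0∧xy≡0⇒y≡0
      (λ eq → All.lookup r≢ s∈ (sym (x∙y⁻¹≈ε⇒x≈y s r eq)))
      (begin
        (s ⊕ ⊖ r) ⊗ horner (quotient r cs) s
          ≡⟨ +-identityˡ _ ⟨
        0# ⊕ (s ⊕ ⊖ r) ⊗ horner (quotient r cs) s
          ≡⟨ cong (λ z → z ⊕ (s ⊕ ⊖ r) ⊗ horner (quotient r cs) s) (root (here refl)) ⟨
        horner (c ∷ cs) r ⊕ (s ⊕ ⊖ r) ⊗ horner (quotient r cs) s
          ≡⟨ cong (λ z → horner (c ∷ cs) r ⊕ (s ⊕ ⊖ r) ⊗ horner (quotient r cs) z) r+[s-r]≡s ⟨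
        horner (c ∷ cs) r ⊕ (s ⊕ ⊖ r) ⊗ horner (quotient r cs) (r ⊕ (s ⊕ ⊖ r))
          ≡⟨ horner-quotient r (s ⊕ ⊖ r) c cs ⟨
        horner (c ∷ cs) (r ⊕ (s ⊕ ⊖ r))
          ≡⟨ cong (horner (c ∷ cs)) r+[s-r]≡s ⟩
        horner (c ∷ cs) s
          ≡⟨ root (there s∈) ⟩
        0# ∎)
      where
      r+[s-r]≡s : r ⊕ (s ⊕ ⊖ r) ≡ s
      r+[s-r]≡s = begin
        r ⊕ (s ⊕ ⊖ r)  ≡⟨ solve 3 (λ r s t → r :+ (s :+ t) := s :+ (r :+ t)) refl r s (⊖ r) ⟩
        s ⊕ (r ⊕ ⊖ r)  ≡⟨ cong (s ⊕_) (-‿inverseʳ r) ⟩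
        s ⊕ 0#         ≡⟨ +-identityʳ s ⟩
        s              ∎

  -- Powers of a primitive element

  module Primitive {ω} (prim : IsPrimitive ω) (ω≢0 : ω ≢ 0#) where

    N : ℕ
    N = size ∸ 1

    instance
      N-nonZero : NonZero N
      N-nonZero = ℕ.>-nonZero (ℕ.≤-pred (subst (2 ≤_) size≡1+ 2≤size))

    pow-cancel : ∀ i d → pow ω i ≡ pow ω (i + d) → pow ω d ≡ 1#
    pow-cancel i d eq = sym (⊗-cancelˡ (pow ω i) (pow≢0 i ω≢0)
      (≡.trans (*-identityʳ _) (≡.trans eq (pow-+ ω i d))))

    order-lower-bound : ∀ d .{{_ : NonZero d}} → pow ω d ≡ 1# → N ≤ d
    order-lower-bound d ω^d≡1 = ℕ.≤-pred (subst (_≤ suc d) size≡1+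
      (subst (λ l → size ≤ suc l) (≡.trans (List.length-map (pow ω) (upTo d)) (List.length-upTo d))
        (covers⇒size≤length cover)))
      where
      cover : ∀ x → x ∈ 0# ∷ map (pow ω) (upTo d)
      cover x with x ≟ 0#
      ... | yes refl = here refl
      ... | no  x≢0 with prim x x≢0
      ...   | j , refl = there (subst (_∈ map (pow ω) (upTo d)) (pow-% ω d ω^d≡1 j)
                           (∈-map⁺ (pow ω) (∈-upTo⁺ (m%n<n j d))))

    -- Among 0 and the powers ω^0, ..., ω^(size-1) two coincide. Since ω is nonzero, both are
    -- powers, so ω^d = 1 for some 0 < d ≤ N, and the lower bound on the order forces d = N.
    pow-N : pow ω N ≡ 1#
    pow-N with Fin.pigeonhole (ℕ.n<1+n size) label
      where
      label : Fin (suc size) → Fin size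
      label Fin.zero    = Inverse.from enum 0#
      label (Fin.suc i) = Inverse.from enum (pow ω (toℕ i))
    ... | Fin.zero  , Fin.suc j , i<j , eq =
      contradiction (sym (from-injective eq)) (pow≢0 (toℕ j) ω≢0)
    ... | Fin.suc i , Fin.suc j , s≤s i<j , eq = subst (λ e → pow ω e ≡ 1#) d≡N ω^d≡1
      where
      d : ℕ
      d = toℕ j ∸ toℕ i
      instance
        d-nonZero : NonZero d
        d-nonZero = ℕ.>-nonZero (ℕ.m<n⇒0<n∸m i<j)
      ω^d≡1 : pow ω d ≡ 1#
      ω^d≡1 = pow-cancel (toℕ i) d (≡.trans (from-injective eq)
        (cong (pow ω) (sym (ℕ.m+[n∸m]≡n (ℕ.<⇒≤ i<j)))))
      d≡N : d ≡ N
      d≡N = ℕ.≤-antisym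
        (ℕ.≤-pred (subst (suc d ≤_) size≡1+ (ℕ.≤-trans (s≤s (ℕ.m∸n≤m (toℕ j) (toℕ i))) (Fin.toℕ<n j))))
        (order-lower-bound d ω^d≡1)

    pow≡1⇒∣ : ∀ i → pow ω i ≡ 1# → N ∣ i
    pow≡1⇒∣ i ω^i≡1 with i % N ℕ.≟ 0
    ... | yes r≡0 = m%n≡0⇒n∣m i N r≡0
    ... | no  r≢0 = contradiction (order-lower-bound (i % N) {{ℕ.≢-nonZero r≢0}} (≡.trans (pow-% ω N pow-N i) ω^i≡1))
      (ℕ.<⇒≱ (m%n<n i N))

    pow-injective : ∀ {i j} → i < j → j < N → pow ω i ≢ pow ω j
    pow-injective {i} {j} i<j j<N eq = ℕ.<⇒≱ (ℕ.≤-<-trans (ℕ.m∸n≤m j i) j<N)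
      (∣⇒≤ {{ℕ.>-nonZero (ℕ.m<n⇒0<n∸m i<j)}} (pow≡1⇒∣ (j ∸ i) (pow-cancel i (j ∸ i)
        (≡.trans eq (cong (pow ω) (sym (ℕ.m+[n∸m]≡n (ℕ.<⇒≤ i<j))))))))

    pow-N-unit : ∀ {x} → x ≢ 0# → pow x N ≡ 1#
    pow-N-unit {x} x≢0 with prim x x≢0
    ... | j , refl = begin
      pow (pow ω j) N  ≡⟨ pow-* ω j N ⟨
      pow ω (j * N)    ≡⟨ cong (pow ω) (ℕ.*-comm j N) ⟩
      pow ω (N * j)    ≡⟨ pow-* ω N j ⟩
      pow (pow ω N) j  ≡⟨ cong (λ z → pow z j) pow-N ⟩
      pow 1# j         ≡⟨ pow-1# j ⟩
      1#               ∎

    pow-size : ∀ x → pow x size ≡ x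
    pow-size x with x ≟ 0#
    ... | yes refl = pow-0# size (ℕ.≤-trans (s≤s z≤n) 2≤size)
    ... | no  x≢0  = begin
      pow x size     ≡⟨ cong (pow x) size≡1+ ⟩
      x ⊗ pow x N    ≡⟨ cong (x ⊗_) (pow-N-unit x≢0) ⟩
      x ⊗ 1#         ≡⟨ *-identityʳ x ⟩
      x              ∎

  -- Characteristic p and the Frobenius map

  module Characteristic {p m : ℕ} (pr : Prime p) (size≡ : size ≡ p ^ m) where

    -- (p · 1)^m = p^m · 1 = size · 1 = 0, and a field has no nonzero nilpotents.
    p·1≡0 : p · 1# ≡ 0#
    p·1≡0 with (p · 1#) ≟ 0#
    ... | yes eq = eq
    ... | no  ne = contradiction (≡.trans (sym (·1-^ m)) (subst (λ n → n · 1# ≡ 0#) size≡ size·1≡0)) (pow≢0 m ne)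
      where
      ·1-^ : ∀ n → (p ^ n) · 1# ≡ pow (p · 1#) n
      ·1-^ zero    = +-identityʳ 1#
      ·1-^ (suc n) = ≡.trans (×1-homo-* p (p ^ n)) (cong (p · 1# ⊗_) (·1-^ n))

    p·≡0 : ∀ x → p · x ≡ 0#
    p·≡0 x = ≡.trans (·-as-⊗ p x) (≡.trans (cong (_⊗ x) p·1≡0) (zeroˡ x))

    ∣⇒·≡0 : ∀ {n} → p ∣ n → ∀ x → n · x ≡ 0#
    ∣⇒·≡0 (divides t refl) x = ≡.trans (sym (×-assocˡ x t p)) (≡.trans (cong (t ·_) (p·≡0 x)) (·-zeroʳ t))

    -- A nonzero remainder of n modulo p would be coprime to p and also kill 1, so Bézout would give
    -- 0 = 1.
    ·1≡0⇒∣ : ∀ n → n · 1# ≡ 0# → p ∣ n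
    ·1≡0⇒∣ n n·1≡0 with n % p ℕ.≟ 0
      where instance _ = prime⇒nonZero pr
    ... | yes r≡0 = m%n≡0⇒n∣m n p {{prime⇒nonZero pr}} r≡0
    ... | no  r≢0 = ⊥-elim (absurd (coprime-Bézout (prime⇒coprime pr {{ℕ.≢-nonZero r≢0}} (m%n<n n p))))
      where
      instance _ = prime⇒nonZero pr
      r·1≡0 : (n % p) · 1# ≡ 0#
      r·1≡0 = begin
        (n % p) · 1#                            ≡⟨ +-identityʳ _ ⟨
        (n % p) · 1# ⊕ 0#                       ≡⟨ cong ((n % p) · 1# ⊕_) (∣⇒·≡0 (n∣m*n (n / p)) 1#) ⟨
        (n % p) · 1# ⊕ (n / p * p) · 1#         ≡⟨ ×-homo-+ 1# (n % p) _ ⟨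
        (n % p + n / p * p) · 1#                ≡⟨ cong (_· 1#) (m≡m%n+[m/n]*n n p) ⟨
        n · 1#                                  ≡⟨ n·1≡0 ⟩
        0#                                      ∎
      multiple : ∀ t k → k · 1# ≡ 0# → (t * k) · 1# ≡ 0#
      multiple t k k·1≡0 = ≡.trans (×1-homo-* t k) (≡.trans (cong (t · 1# ⊗_) k·1≡0) (zeroʳ _))
      one≡0 : ∀ s t k l → k · 1# ≡ 0# → l · 1# ≡ 0# → 1 + s * k ≡ t * l → 0# ≡ 1#
      one≡0 s t k l k≡0 l≡0 eq = begin
        0#                      ≡⟨ multiple t l l≡0 ⟨
        (t * l) · 1#            ≡⟨ cong (_· 1#) eq ⟨
        1# ⊕ (s * k) · 1#       ≡⟨ cong (1# ⊕_) (multiple s k k≡0) ⟩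
        1# ⊕ 0#                 ≡⟨ +-identityʳ 1# ⟩
        1#                      ∎
      absurd : Bézout.Identity 1 p (n % p) → ⊥
      absurd (Bézout.+- x y eq) = 0≢1 (one≡0 y x (n % p) p r·1≡0 p·1≡0 eq)
      absurd (Bézout.-+ x y eq) = 0≢1 (one≡0 x y p (n % p) p·1≡0 r·1≡0 eq)

    frobenius-⊕ : ∀ x y → pow (x ⊕ y) p ≡ pow x p ⊕ pow y p
    frobenius-⊕ x y = begin
      pow (x ⊕ y) p
        ≡⟨ pow≡^ (x ⊕ y) p ⟩
      (x ⊕ y) E.^ p
        ≡⟨ Binom.theorem p x y ⟩
      S.sum (Binom.binomialTerm x y p)
        ≡⟨ endpoints p refl ⟩
      pow x p ⊕ pow y p ∎
      where
      module E = Algebra.Properties.Semiring.Exp semiring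
      module S = Algebra.Properties.Semiring.Sum semiring
      module Binom = Algebra.Properties.CommutativeSemiring.Binomial commutativeSemiring
      pow≡^ : ∀ z n → pow z n ≡ z E.^ n
      pow≡^ z zero    = refl
      pow≡^ z (suc n) = cong (z ⊗_) (pow≡^ z n)

      -- `q` is kept apart from `p` so that it can be split as a successor, which exposes the first
      -- and last binomial terms; the middle ones vanish by `prime∣C`.
      endpoints : ∀ q → q ≡ p → S.sum (Binom.binomialTerm x y q) ≡ pow x q ⊕ pow y q
      endpoints zero    eq = ⊥-elim (ℕ.≢-nonZero⁻¹ p {{prime⇒nonZero pr}} (sym eq))
      endpoints (suc q) eq = begin
        S.sum (Binom.binomialTerm x y (suc q))
          ≡⟨ cong (first ⊕_) (S.sum-init-last rest) ⟩
        first ⊕ (S.sum (Vector.init rest) ⊕ Vector.last rest)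
          ≡⟨ cong (λ z → first ⊕ (z ⊕ Vector.last rest)) (≡.trans (S.sum-cong-≗ middle) (S.sum-replicate-zero q)) ⟩
        first ⊕ (0# ⊕ Vector.last rest)
          ≡⟨ cong₂ (λ u v → u ⊕ (0# ⊕ v)) first≡ last≡ ⟩
        pow y (suc q) ⊕ (0# ⊕ pow x (suc q))
          ≡⟨ solve 2 (λ u v → v :+ (con 0 :+ u) := u :+ v) refl (pow x (suc q)) (pow y (suc q)) ⟩
        pow x (suc q) ⊕ pow y (suc q) ∎
        where
        first : Carrier
        first = Binom.binomialTerm x y (suc q) Fin.zero
        rest : Vector.Vector Carrier (suc q)
        rest i = Binom.binomialTerm x y (suc q) (Fin.suc i)

        first≡ : first ≡ pow y (suc q)
        first≡ = ≡.trans (+-identityʳ _) (≡.trans (*-identityˡ _) (sym (pow≡^ y (suc q))))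

        last-term : ∀ k → k ≡ suc q →
          (suc q C k) · ((x E.^ k) ⊗ (y E.^ (suc q ∸ k))) ≡ pow x (suc q)
        last-term k refl = begin
          (suc q C suc q) · ((x E.^ suc q) ⊗ (y E.^ (q ∸ q)))
            ≡⟨ cong₂ (λ c e → c · ((x E.^ suc q) ⊗ (y E.^ e))) (nCn≡1 (suc q)) (ℕ.n∸n≡0 q) ⟩
          (x E.^ suc q) ⊗ 1# ⊕ 0#
            ≡⟨ ≡.trans (+-identityʳ _) (*-identityʳ _) ⟩
          x E.^ suc q
            ≡⟨ pow≡^ x (suc q) ⟨
          pow x (suc q) ∎

        last≡ : Vector.last rest ≡ pow x (suc q)
        last≡ = last-term (suc (toℕ (fromℕ q))) (cong suc (Fin.toℕ-fromℕ q))

        middle : ∀ i → Vector.init rest i ≡ 0#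
        middle i = ∣⇒·≡0 (subst (λ r → p ∣ r C toℕ (Fin.suc (inject₁ i))) (sym eq)
          (prime∣C pr _ (s≤s z≤n) (subst (toℕ (Fin.suc (inject₁ i)) <_) eq
            (s≤s (subst (_< q) (sym (Fin.toℕ-inject₁ i)) (Fin.toℕ<n i)))))) _

    frobenius^-⊕ : ∀ j x y → pow (x ⊕ y) (p ^ j) ≡ pow x (p ^ j) ⊕ pow y (p ^ j)
    frobenius^-⊕ zero    x y = distribʳ 1# x y
    frobenius^-⊕ (suc j) x y = begin
      pow (x ⊕ y) (p * p ^ j)                             ≡⟨ pow-* (x ⊕ y) p (p ^ j) ⟩
      pow (pow (x ⊕ y) p) (p ^ j)                         ≡⟨ cong (λ z → pow z (p ^ j)) (frobenius-⊕ x y) ⟩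
      pow (pow x p ⊕ pow y p) (p ^ j)                     ≡⟨ frobenius^-⊕ j (pow x p) (pow y p) ⟩
      pow (pow x p) (p ^ j) ⊕ pow (pow y p) (p ^ j)       ≡⟨ cong₂ _⊕_ (pow-* x p (p ^ j)) (pow-* y p (p ^ j)) ⟨
      pow x (p * p ^ j) ⊕ pow y (p * p ^ j)               ∎

    p^≢0 : ∀ j → 0 < p ^ j
    p^≢0 j = ℕ.m^n>0 p {{prime⇒nonZero pr}} j

    frobenius^-∑ : ∀ j {B : Set} (xs : List B) (f : B → Carrier) →
                   pow (∑ xs f) (p ^ j) ≡ ∑ xs (λ x → pow (f x) (p ^ j))
    frobenius^-∑ j = BigSumHom.∑-hom +-isCommutativeMonoid +-isCommutativeMonoid
      (λ x → pow x (p ^ j)) (pow-0# (p ^ j) (p^≢0 j)) (frobenius^-⊕ j)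

    module _ {ω} (prim : IsPrimitive ω) (ω≢0 : ω ≢ 0#) where
      open Primitive prim ω≢0

      -- Raising an equality of the conjugates i < j to the power p^(m-i) wraps around to g =
      -- g^(p^t) with t = j - i. Hence ω^(k(p^t-1)) = 1, so kn divides k(p^t-1) and n divides p^t -
      -- 1 with 0 < t < m, against primitivity.
      conjugates-distinct : ∀ k n .{{_ : NonZero k}} → k * n ≡ p ^ m ∸ 1 → IsPrimitiveDivisor n p m →
        ∀ {i j} → i < j → j < m → pow (pow ω k) (p ^ i) ≢ pow (pow ω k) (p ^ j)
      conjugates-distinct k n kn≡ (_ , n-prim) {i} {j} i<j j<m eq =
        n-prim t (ℕ.m<n⇒0<n∸m i<j) (ℕ.≤-<-trans (ℕ.m∸n≤m j i) j<m)
          (*-cancelˡ-∣ k (subst (_∣ k * (p ^ t ∸ 1)) (≡.trans (cong (_∸ 1) size≡) (sym kn≡))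
            (pow≡1⇒∣ (k * (p ^ t ∸ 1)) (pow-cancel k (k * (p ^ t ∸ 1)) fixed))))
        where
        t : ℕ
        t = j ∸ i
        g : Carrier
        g = pow ω k

        pow-p^m : ∀ x → pow x (p ^ m) ≡ x
        pow-p^m x = subst (λ e → pow x e ≡ x) size≡ (pow-size x)

        pow-p^ : ∀ d e → pow (pow g (p ^ d)) (p ^ e) ≡ pow g (p ^ (d + e))
        pow-p^ d e = ≡.trans (sym (pow-* g (p ^ d) (p ^ e))) (cong (pow g) (sym (ℕ.^-distribˡ-+-* p d e)))

        shift-exponent : j + (m ∸ i) ≡ t + m
        shift-exponent = begin
          j + (m ∸ i)                ≡⟨ cong (_+ (m ∸ i)) (ℕ.m∸n+n≡m (ℕ.<⇒≤ i<j)) ⟨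
          (t + i) + (m ∸ i)          ≡⟨ ℕ.+-assoc t i (m ∸ i) ⟩
          t + (i + (m ∸ i))          ≡⟨ cong (t +_) (ℕ.m+[n∸m]≡n (ℕ.<⇒≤ (ℕ.<-trans i<j j<m))) ⟩
          t + m                      ∎

        g≡g^p^t : g ≡ pow g (p ^ t)
        g≡g^p^t = begin
          g                                   ≡⟨ pow-p^m g ⟨
          pow g (p ^ m)                       ≡⟨ cong (λ e → pow g (p ^ e)) (ℕ.m+[n∸m]≡n (ℕ.<⇒≤ (ℕ.<-trans i<j j<m))) ⟨
          pow g (p ^ (i + (m ∸ i)))           ≡⟨ pow-p^ i (m ∸ i) ⟨
          pow (pow g (p ^ i)) (p ^ (m ∸ i))   ≡⟨ cong (λ z → pow z (p ^ (m ∸ i))) eq ⟩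
          pow (pow g (p ^ j)) (p ^ (m ∸ i))   ≡⟨ pow-p^ j (m ∸ i) ⟩
          pow g (p ^ (j + (m ∸ i)))           ≡⟨ cong (λ e → pow g (p ^ e)) shift-exponent ⟩
          pow g (p ^ (t + m))                 ≡⟨ pow-p^ t m ⟨
          pow (pow g (p ^ t)) (p ^ m)         ≡⟨ pow-p^m _ ⟩
          pow g (p ^ t)                       ∎

        fixed : pow ω k ≡ pow ω (k + k * (p ^ t ∸ 1))
        fixed = begin
          g                                ≡⟨ g≡g^p^t ⟩
          pow g (p ^ t)                    ≡⟨ pow-* ω k (p ^ t) ⟨
          pow ω (k * p ^ t)                ≡⟨ cong (λ e → pow ω (k * e)) (ℕ.m+[n∸m]≡n (p^≢0 t)) ⟨
          pow ω (k * suc (p ^ t ∸ 1))      ≡⟨ cong (pow ω) (ℕ.*-suc k (p ^ t ∸ 1)) ⟩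
          pow ω (k + k * (p ^ t ∸ 1))      ∎

      trace≡∑ : ∀ l x → trace p l x ≡ ∑ (upTo l) (λ j → pow x (p ^ j))
      trace≡∑ l x = fsum-map≡∑ (λ j → pow x (p ^ j)) (upTo l)

      -- The coordinates of the codeword of γ are ∑ⱼ γ^(p^j) (g^(p^j))^i with g = ω^k, and the
      -- conjugates g^(p^j) are distinct, so the coefficients γ^(p^j) are determined.
      codeword-injective : ∀ k n → 1 ≤ k → 1 ≤ n → 1 ≤ m → k * n ≡ p ^ m ∸ 1 → IsPrimitiveDivisor n p m →
        ∀ {γ γ′} → (∀ i → i < n → trace p m (γ ⊗ pow ω (k * i)) ≡ trace p m (γ′ ⊗ pow ω (k * i))) → γ ≡ γ′
      codeword-injective k n 1≤k 1≤n 1≤m kn≡ n-prim {γ} {γ′} agree =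
        -- Only the coefficient for j = 0 is used; it is γ - γ′ because p^0 = 1.
        ≡.trans (sym (pow-1 γ)) (≡.trans (x∙y⁻¹≈ε⇒x≈y _ _
          (vandermonde (upTo m) c (λ j → pow g (p ^ j)) distinct rel (∈-upTo⁺ 1≤m))) (pow-1 γ′))
        where
        instance
          k-nonZero : NonZero k
          k-nonZero = ℕ.>-nonZero 1≤k
          n-nonZero : NonZero n
          n-nonZero = ℕ.>-nonZero 1≤n
        g : Carrier
        g = pow ω k
        c : ℕ → Carrier
        c j = pow γ (p ^ j) ⊕ ⊖ pow γ′ (p ^ j)

        distinct : Unique (map (λ j → pow g (p ^ j)) (upTo m))
        distinct = subst Unique (sym (List.map-upTo (λ j → pow g (p ^ j)) m))
          (Unique.applyUpTo⁺₁ _ m (conjugates-distinct k n kn≡ n-prim))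

        g^n≡1 : pow g n ≡ 1#
        g^n≡1 = ≡.trans (sym (pow-* ω k n)) (≡.trans (cong (pow ω) (≡.trans kn≡ (cong (_∸ 1) (sym size≡)))) pow-N)

        -- `vandermonde` asks for every exponent i, while the codeword has only n coordinates; g^n =
        -- 1 makes them periodic.
        coordinate : ∀ δ i → trace p m (δ ⊗ pow ω (k * (i % n))) ≡ ∑ (upTo m) (λ j → pow δ (p ^ j) ⊗ pow (pow g (p ^ j)) i)
        coordinate δ i = ≡.trans (trace≡∑ m _) (∑-cong (upTo m) λ j _ → begin
          pow (δ ⊗ pow ω (k * (i % n))) (p ^ j)
            ≡⟨ cong (λ z → pow (δ ⊗ z) (p ^ j)) (≡.trans (pow-* ω k (i % n)) (pow-% g n g^n≡1 i)) ⟩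
          pow (δ ⊗ pow g i) (p ^ j)
            ≡⟨ pow-⊗ δ (pow g i) (p ^ j) ⟩
          pow δ (p ^ j) ⊗ pow (pow g i) (p ^ j)
            ≡⟨ cong (pow δ (p ^ j) ⊗_) (pow-comm g i (p ^ j)) ⟩
          pow δ (p ^ j) ⊗ pow (pow g (p ^ j)) i ∎)

        rel : ∀ i → ∑ (upTo m) (λ j → c j ⊗ pow (pow g (p ^ j)) i) ≡ 0#
        rel i = begin
          ∑ (upTo m) (λ j → c j ⊗ pow (pow g (p ^ j)) i)
            ≡⟨ ∑-cong (upTo m) (λ j _ → ≡.trans (distribʳ _ _ _)
                 (cong (pow γ (p ^ j) ⊗ pow (pow g (p ^ j)) i ⊕_) (⊖-⊗ _ _))) ⟩
          ∑ (upTo m) (λ j → pow γ (p ^ j) ⊗ pow (pow g (p ^ j)) i ⊕ ⊖ 1# ⊗ (pow γ′ (p ^ j) ⊗ pow (pow g (p ^ j)) i))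
            ≡⟨ ∑-∙ (upTo m) _ _ ⟩
          ∑ (upTo m) (λ j → pow γ (p ^ j) ⊗ pow (pow g (p ^ j)) i)
            ⊕ ∑ (upTo m) (λ j → ⊖ 1# ⊗ (pow γ′ (p ^ j) ⊗ pow (pow g (p ^ j)) i))
            ≡⟨ cong₂ _⊕_ (coordinate γ i) (⊗-distribˡ-∑ (⊖ 1#) (upTo m) _) ⟨
          trace p m (γ ⊗ pow ω (k * (i % n))) ⊕ ⊖ 1# ⊗ ∑ (upTo m) (λ j → pow γ′ (p ^ j) ⊗ pow (pow g (p ^ j)) i)
            ≡⟨ cong₂ _⊕_ (agree (i % n) (m%n<n i n)) (≡.trans (-1*x≈-x _) (cong ⊖_ (sym (coordinate γ′ i)))) ⟩
          trace p m (γ′ ⊗ pow ω (k * (i % n))) ⊕ ⊖ trace p m (γ′ ⊗ pow ω (k * (i % n)))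
            ≡⟨ -‿inverseʳ _ ⟩
          0# ∎
          where
          ⊖-⊗ : ∀ x y → ⊖ x ⊗ y ≡ ⊖ 1# ⊗ (x ⊗ y)
          ⊖-⊗ x y = ≡.trans (sym (-‿distribˡ-* x y)) (sym (-1*x≈-x (x ⊗ y)))

-- Polynomials with coefficients in ℕ, as lists of exponents of their monomials

infixl 7 _⊛_

_⊛_ : List ℕ → List ℕ → List ℕ
f ⊛ g = concatMap (λ i → map (i +_) g) f

_⊛^_ : List ℕ → ℕ → List ℕ
f ⊛^ zero  = [ 0 ]
f ⊛^ suc n = f ⊛ (f ⊛^ n)

copies : ℕ → List ℕ → List ℕ
copies zero    f = []
copies (suc n) f = f ++ copies n f

-- The remainder of X^e modulo X^q - X is X^(reduce q e).
reduce : ℕ → ℕ → ℕ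
reduce q zero    = 0
reduce q (suc e) with suc (reduce q e) ℕ.<? q
... | yes _ = suc (reduce q e)
... | no  _ = 1

reduce< : ∀ q → 2 ≤ q → ∀ e → reduce q e < q
reduce< q 2≤q zero    = ℕ.≤-trans (s≤s z≤n) 2≤q
reduce< q 2≤q (suc e) with suc (reduce q e) ℕ.<? q
... | yes lt = lt
... | no  _  = 2≤q

increment : ℕ → List ℕ → List ℕ
increment i       []       = []
increment zero    (n ∷ ns) = suc n ∷ ns
increment (suc i) (n ∷ ns) = n ∷ increment i ns

length-increment : ∀ i ns → length (increment i ns) ≡ length ns
length-increment i       []       = refl
length-increment zero    (n ∷ ns) = refl
length-increment (suc i) (n ∷ ns) = cong suc (length-increment i ns)

-- The remainder modulo X^q - X. Its length is always q, the number of roots available to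
-- `too-many-roots` in a field with q elements.
coefficients : ℕ → List ℕ → List ℕ
coefficients q []      = replicate q 0
coefficients q (e ∷ f) = increment (reduce q e) (coefficients q f)

length-coefficients : ∀ q f → length (coefficients q f) ≡ q
length-coefficients q []      = List.length-replicate q
length-coefficients q (e ∷ f) = ≡.trans (length-increment (reduce q e) (coefficients q f)) (length-coefficients q f)

-- Evaluation in a finite field

module Evaluation (F : FiniteField) where
  open FiniteField F
  open Field F
  open Algebra.Solver.Ring.NaturalCoefficients.Default commutativeSemiring using (solve; _:=_; _:+_; _:*_)
  open ≡.≡-Reasoning

  eval : List ℕ → Carrier → Carrier
  eval f x = ∑ f (pow x)

  eval-⊛ : ∀ f g x → eval (f ⊛ g) x ≡ eval f x ⊗ eval g x
  eval-⊛ f g x = begin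
    ∑ (f ⊛ g) (pow x)                           ≡⟨ ∑-concatMap (λ i → map (i +_) g) f (pow x) ⟩
    ∑ f (λ i → ∑ (map (i +_) g) (pow x))        ≡⟨ ∑-cong f (λ i _ → begin
      ∑ (map (i +_) g) (pow x)                    ≡⟨ ∑-map (i +_) g (pow x) ⟩
      ∑ g (λ j → pow x (i + j))                   ≡⟨ ∑-cong g (λ j _ → pow-+ x i j) ⟩
      ∑ g (λ j → pow x i ⊗ pow x j)               ≡⟨ ⊗-distribˡ-∑ (pow x i) g (pow x) ⟨
      pow x i ⊗ eval g x                          ≡⟨ *-comm _ _ ⟩
      eval g x ⊗ pow x i                          ∎) ⟩
    ∑ f (λ i → eval g x ⊗ pow x i)              ≡⟨ ⊗-distribˡ-∑ (eval g x) f (pow x) ⟨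
    eval g x ⊗ eval f x                         ≡⟨ *-comm _ _ ⟩
    eval f x ⊗ eval g x                         ∎

  eval-⊛^ : ∀ f n x → eval (f ⊛^ n) x ≡ pow (eval f x) n
  eval-⊛^ f zero    x = +-identityʳ 1#
  eval-⊛^ f (suc n) x = ≡.trans (eval-⊛ f (f ⊛^ n) x) (cong (eval f x ⊗_) (eval-⊛^ f n x))

  eval-copies : ∀ n f x → eval (copies n f) x ≡ n · eval f x
  eval-copies zero    f x = refl
  eval-copies (suc n) f x = ≡.trans (∑-++ f (copies n f) (pow x)) (cong (eval f x ⊕_) (eval-copies n f x))

  pow-reduce : ∀ q → 2 ≤ q → ∀ x → pow x q ≡ x → ∀ e → pow x (reduce q e) ≡ pow x e
  pow-reduce q 2≤q x x^q≡x zero    = refl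
  pow-reduce q 2≤q x x^q≡x (suc e) with suc (reduce q e) ℕ.<? q
  ... | yes _ = cong (x ⊗_) (pow-reduce q 2≤q x x^q≡x e)
  -- Here `suc (reduce q e)` equals q, and x^q = x restarts the exponent at 1.
  ... | no ≮q = begin
    pow x 1                   ≡⟨ pow-1 x ⟩
    x                         ≡⟨ x^q≡x ⟨
    pow x q                   ≡⟨ cong (pow x) (ℕ.≤-antisym (reduce< q 2≤q e) (ℕ.≮⇒≥ ≮q)) ⟨
    x ⊗ pow x (reduce q e)    ≡⟨ cong (x ⊗_) (pow-reduce q 2≤q x x^q≡x e) ⟩
    x ⊗ pow x e               ∎

  hornerℕ : List ℕ → Carrier → Carrier
  hornerℕ ns = horner (map (_· 1#) ns)

  hornerℕ-increment : ∀ i ns x → i < length ns → hornerℕ (increment i ns) x ≡ pow x i ⊕ hornerℕ ns x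
  hornerℕ-increment zero    (n ∷ ns) x _        = +-assoc 1# (n · 1#) _
  hornerℕ-increment (suc i) (n ∷ ns) x (s≤s i<) = begin
    n · 1# ⊕ x ⊗ hornerℕ (increment i ns) x   ≡⟨ cong (λ z → n · 1# ⊕ x ⊗ z) (hornerℕ-increment i ns x i<) ⟩
    n · 1# ⊕ x ⊗ (pow x i ⊕ hornerℕ ns x)     ≡⟨ solve 4 (λ n x y h → n :+ x :* (y :+ h) := x :* y :+ (n :+ x :* h))
                                                   refl (n · 1#) x (pow x i) (hornerℕ ns x) ⟩
    x ⊗ pow x i ⊕ (n · 1# ⊕ x ⊗ hornerℕ ns x) ∎

  -- q is not tied to the size of the field: the same remainder, with q the size of the large field,
  -- is evaluated in the small one as well.
  eval≡hornerℕ : ∀ q → 2 ≤ q → ∀ x → pow x q ≡ x → ∀ f → eval f x ≡ hornerℕ (coefficients q f) x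
  eval≡hornerℕ q 2≤q x x^q≡x []      = sym (horner-zero x (zeros q))
    where
    zeros : ∀ k → All (_≡ 0#) (map (_· 1#) (replicate k 0))
    zeros zero    = []
    zeros (suc k) = refl ∷ zeros k
  eval≡hornerℕ q 2≤q x x^q≡x (e ∷ f) = begin
    pow x e ⊕ eval f x
      ≡⟨ cong₂ _⊕_ (sym (pow-reduce q 2≤q x x^q≡x e)) (eval≡hornerℕ q 2≤q x x^q≡x f) ⟩
    pow x (reduce q e) ⊕ hornerℕ (coefficients q f) x
      ≡⟨ hornerℕ-increment (reduce q e) (coefficients q f) x
           (subst (reduce q e <_) (sym (length-coefficients q f)) (reduce< q 2≤q e)) ⟨
    hornerℕ (coefficients q (e ∷ f)) x ∎

  pow-fixed : ∀ q x → pow x q ≡ x → ∀ l → pow x (q ^ l) ≡ x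
  pow-fixed q x x^q≡x zero    = pow-1 x
  pow-fixed q x x^q≡x (suc l) =
    ≡.trans (pow-* x q (q ^ l)) (≡.trans (cong (λ z → pow z (q ^ l)) x^q≡x) (pow-fixed q x x^q≡x l))

  module Difference {p m : ℕ} (pr : Prime p) (size≡ : size ≡ p ^ m) where
    open Characteristic {m = m} pr size≡

    -- Coefficients in ℕ cannot be negated; in characteristic p, however, -1 equals p - 1.
    difference : List ℕ → List ℕ → List ℕ
    difference f g = f ++ copies (p ∸ 1) g

    eval-difference : ∀ f g x → eval (difference f g) x ≡ eval f x ⊕ ⊖ eval g x
    eval-difference f g x = ≡.trans (∑-++ f (copies (p ∸ 1) g) (pow x)) (cong (eval f x ⊕_)
      (inverseʳ-unique (eval g x) _ (begin
        eval g x ⊕ eval (copies (p ∸ 1) g) x     ≡⟨ cong (eval g x ⊕_) (eval-copies (p ∸ 1) g x) ⟩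
        suc (p ∸ 1) · eval g x                   ≡⟨ cong (_· eval g x) (ℕ.suc-pred p {{prime⇒nonZero pr}}) ⟩
        p · eval g x                             ≡⟨ p·≡0 (eval g x) ⟩
        0#                                       ∎)))

-- Embedding a finite field into another

module Embedding
  {p a m b : ℕ} (pr : Prime p) (m≡ab : m ≡ a * b)
  (F₀ F : FiniteField) (size₀≡ : FiniteField.size F₀ ≡ p ^ a) (size≡ : FiniteField.size F ≡ p ^ m)
  {ω₀ : FiniteField.Carrier F₀} (prim₀ : FiniteField.IsPrimitive F₀ ω₀) (ω₀≢0 : ω₀ ≢ FiniteField.0# F₀)
  {ω : FiniteField.Carrier F} (prim : FiniteField.IsPrimitive F ω) (ω≢0 : ω ≢ FiniteField.0# F)
  where

  private
    module K = FiniteField F₀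
    module KF = Field F₀
    module KE = Evaluation F₀
    module KC = KF.Characteristic {m = a} pr size₀≡
    module KP = KF.Primitive prim₀ ω₀≢0
    module KD = KE.Difference {m = a} pr size₀≡
  open FiniteField F
  open Field F
  open Evaluation F
  open Characteristic {m = m} pr size≡
  open Difference {m = m} pr size≡
  open Primitive prim ω≢0

  -- The remainder of `f` modulo X^q - X has q coefficients and vanishes at all q elements of F, so
  -- p divides each coefficient and they vanish in `F₀` too. Passing to the remainder is harmless
  -- there, since q = (p^a)^b makes y^q = y.
  vanishing-transfer : ∀ f → (∀ x → eval f x ≡ 0#) → ∀ y → KE.eval f y ≡ K.0#
  vanishing-transfer f vanish y =
    ≡.trans (KE.eval≡hornerℕ size 2≤size y y^size≡y f)
      (KF.horner-zero y (All.map⁺ (All.map (λ {n} n·1≡0 → KC.∣⇒·≡0 (·1≡0⇒∣ n n·1≡0) K.1#) (All.map⁻ zeros))))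
    where
    zeros : All (_≡ 0#) (map (_· 1#) (coefficients size f))
    zeros = too-many-roots _ elements elements!
      (ℕ.≤-reflexive (≡.trans (List.length-map (_· 1#) (coefficients size f))
        (≡.trans (length-coefficients size f) (sym length-elements))))
      (λ {x} _ → ≡.trans (sym (eval≡hornerℕ size 2≤size x (pow-size x) f)) (vanish x))

    y^size≡y : K.pow y size ≡ y
    y^size≡y = begin
      K.pow y size            ≡⟨ cong (K.pow y) (≡.trans size≡ (≡.trans (cong (p ^_) m≡ab) (sym (ℕ.^-*-assoc p a b)))) ⟩
      K.pow y ((p ^ a) ^ b)   ≡⟨ KE.pow-fixed (p ^ a) y (subst (λ e → K.pow y e ≡ y) size₀≡ (KP.pow-size y)) b ⟩
      y                       ∎
      where open ≡.≡-Reasoning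

  -- Equivalently, x is a root of every polynomial over the prime field that vanishes at ω₀.
  Conjugate : Carrier → Set
  Conjugate x = ∀ f g → KE.eval f ω₀ ≡ KE.eval g ω₀ → eval f x ≡ eval g x

  Separates : List Carrier → List ℕ → Set
  Separates xs h = KE.eval h ω₀ ≡ K.1# × (∀ {x} → x ∈ xs → eval h x ≡ 0#)

  -- If d vanishes at ω₀ but not at x, then 1 - d^(q-1) is 1 at ω₀ and vanishes at x.
  separate : (∀ x → ¬ Conjugate x) → ∀ xs → ¬ ¬ ∃ (Separates xs)
  separate none []       k = k ([ 0 ] , KF.+-identityʳ K.1# , λ ())
  separate none (x ∷ xs) k = separate none xs λ (h , h[ω₀]≡1 , h[xs]≡0) →
    -- Refuting `Conjugate x` yields no explicit pair of polynomials. Instead `Conjugate x` is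
    -- proved: a pair with different values at `x` would give a separating polynomial for `x ∷ xs`,
    -- which `k` excludes.
    none x λ f g f≡g → decidable-stable (eval f x ≟ eval g x) λ f≢g → k
      ( factor f g ⊛ h
      , ≡.trans (KE.eval-⊛ (factor f g) h ω₀)
          (≡.trans (cong₂ K._⊗_ (factor[ω₀]≡1 f g f≡g) h[ω₀]≡1) (KF.*-identityˡ K.1#))
      , λ { (here refl) → ≡.trans (eval-⊛ (factor f g) h x) (≡.trans (cong (_⊗ eval h x) (factor[x]≡0 f g f≢g)) (zeroˡ _))
          ; {y} (there y∈)  → ≡.trans (eval-⊛ (factor f g) h y) (≡.trans (cong (eval (factor f g) y ⊗_) (h[xs]≡0 y∈)) (zeroʳ _)) })
    where
    open ≡.≡-Reasoning
    factor : List ℕ → List ℕ → List ℕ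
    factor f g = difference [ 0 ] (difference f g ⊛^ N)

    factor[ω₀]≡1 : ∀ f g → KE.eval f ω₀ ≡ KE.eval g ω₀ → KE.eval (factor f g) ω₀ ≡ K.1#
    factor[ω₀]≡1 f g f≡g = begin
      KE.eval (factor f g) ω₀
        ≡⟨ KD.eval-difference [ 0 ] (difference f g ⊛^ N) ω₀ ⟩
      KE.eval [ 0 ] ω₀ K.⊕ K.⊖ KE.eval (difference f g ⊛^ N) ω₀
        ≡⟨ cong₂ (λ u v → u K.⊕ K.⊖ v) (KF.+-identityʳ K.1#) (KE.eval-⊛^ (difference f g) N ω₀) ⟩
      K.1# K.⊕ K.⊖ K.pow (KE.eval (difference f g) ω₀) N
        ≡⟨ cong (λ z → K.1# K.⊕ K.⊖ K.pow z N) (≡.trans (KD.eval-difference f g ω₀) (KF.x≈y⇒x∙y⁻¹≈ε f≡g)) ⟩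
      K.1# K.⊕ K.⊖ K.pow K.0# N
        ≡⟨ cong (λ z → K.1# K.⊕ K.⊖ z) (KF.pow-0# N (ℕ.>-nonZero⁻¹ N)) ⟩
      K.1# K.⊕ K.⊖ K.0#
        ≡⟨ cong (λ z → K.1# K.⊕ z) KF.ε⁻¹≈ε ⟩
      K.1# K.⊕ K.0#
        ≡⟨ KF.+-identityʳ K.1# ⟩
      K.1# ∎

    factor[x]≡0 : ∀ f g → eval f x ≢ eval g x → eval (factor f g) x ≡ 0#
    factor[x]≡0 f g f≢g = begin
      eval (factor f g) x
        ≡⟨ eval-difference [ 0 ] (difference f g ⊛^ N) x ⟩
      eval [ 0 ] x ⊕ ⊖ eval (difference f g ⊛^ N) x
        ≡⟨ cong₂ (λ u v → u ⊕ ⊖ v) (+-identityʳ 1#) (eval-⊛^ (difference f g) N x) ⟩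
      1# ⊕ ⊖ pow (eval (difference f g) x) N
        ≡⟨ cong (λ z → 1# ⊕ ⊖ z) (pow-N-unit λ eq → f≢g (x∙y⁻¹≈ε⇒x≈y _ _ (≡.trans (sym (eval-difference f g x)) eq))) ⟩
      1# ⊕ ⊖ 1#
        ≡⟨ -‿inverseʳ 1# ⟩
      0# ∎

  conjugate-exists : ¬ ¬ ∃ Conjugate
  conjugate-exists none = separate (λ x x-conj → none (x , x-conj)) elements λ (h , h[ω₀]≡1 , h≡0) →
    K.0≢1 (≡.trans (sym (vanishing-transfer h (λ x → h≡0 (∈-elements x)) ω₀)) h[ω₀]≡1)

  module Homomorphism {ξ} (conj : Conjugate ξ) where
    open ≡.≡-Reasoning

    representative : ∀ y → ∃ λ f → KE.eval f ω₀ ≡ y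
    representative y with y K.≟ K.0#
    ... | yes refl = [] , refl
    ... | no y≢0 with prim₀ y y≢0
    ...   | j , eq = [ j ] , ≡.trans (KF.+-identityʳ _) eq

    -- Sends f(ω₀) to f(ξ). By `conj` the result does not depend on the polynomial chosen, so each
    -- homomorphism law is checked on whichever representative suits it.
    φ : K.Carrier → Carrier
    φ y = eval (proj₁ (representative y)) ξ

    φ-eval : ∀ f → φ (KE.eval f ω₀) ≡ eval f ξ
    φ-eval f = let g , eq = representative (KE.eval f ω₀) in conj g f eq

    φ-0 : φ K.0# ≡ 0#
    φ-0 = φ-eval []

    φ-1 : φ K.1# ≡ 1#
    φ-1 = ≡.trans (cong φ (sym (KF.+-identityʳ K.1#))) (≡.trans (φ-eval [ 0 ]) (+-identityʳ 1#))

    φ-⊕ : ∀ y z → φ (y K.⊕ z) ≡ φ y ⊕ φ z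
    φ-⊕ y z with representative y | representative z
    ... | f , refl | g , refl = begin
      φ (KE.eval f ω₀ K.⊕ KE.eval g ω₀)   ≡⟨ cong φ (KF.∑-++ f g (K.pow ω₀)) ⟨
      φ (KE.eval (f ++ g) ω₀)             ≡⟨ φ-eval (f ++ g) ⟩
      eval (f ++ g) ξ                     ≡⟨ ∑-++ f g (pow ξ) ⟩
      eval f ξ ⊕ eval g ξ                 ∎

    φ-⊗ : ∀ y z → φ (y K.⊗ z) ≡ φ y ⊗ φ z
    φ-⊗ y z with representative y | representative z
    ... | f , refl | g , refl = begin
      φ (KE.eval f ω₀ K.⊗ KE.eval g ω₀)   ≡⟨ cong φ (KE.eval-⊛ f g ω₀) ⟨
      φ (KE.eval (f ⊛ g) ω₀)              ≡⟨ φ-eval (f ⊛ g) ⟩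
      eval (f ⊛ g) ξ                      ≡⟨ eval-⊛ f g ξ ⟩
      eval f ξ ⊗ eval g ξ                 ∎

    φ-pow : ∀ y n → φ (K.pow y n) ≡ pow (φ y) n
    φ-pow y zero    = φ-1
    φ-pow y (suc n) = ≡.trans (φ-⊗ y (K.pow y n)) (cong (φ y ⊗_) (φ-pow y n))

    φ-trace : ∀ l y → φ (K.trace p l y) ≡ trace p l (φ y)
    φ-trace l y = begin
      φ (K.trace p l y)                              ≡⟨ cong φ (KF.fsum-map≡∑ (λ j → K.pow y (p ^ j)) (upTo l)) ⟩
      φ (KF.∑ (upTo l) (λ j → K.pow y (p ^ j)))      ≡⟨ BigSumHom.∑-hom KF.+-isCommutativeMonoid +-isCommutativeMonoid φ φ-0 φ-⊕
                                                          (upTo l) (λ j → K.pow y (p ^ j)) ⟩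
      ∑ (upTo l) (λ j → φ (K.pow y (p ^ j)))         ≡⟨ ∑-cong (upTo l) (λ j _ → φ-pow y (p ^ j)) ⟩
      ∑ (upTo l) (λ j → pow (φ y) (p ^ j))           ≡⟨ fsum-map≡∑ (λ j → pow (φ y) (p ^ j)) (upTo l) ⟨
      trace p l (φ y)                                ∎

    φ≡0⇒≡0 : ∀ y → φ y ≡ 0# → y ≡ K.0#
    φ≡0⇒≡0 y φy≡0 = decidable-stable (y K.≟ K.0#) λ y≢0 → let z , yz≡1 = K.inverse y y≢0 in 0≢1 (begin
      0#            ≡⟨ zeroˡ (φ z) ⟨
      0# ⊗ φ z      ≡⟨ cong (_⊗ φ z) φy≡0 ⟨
      φ y ⊗ φ z     ≡⟨ φ-⊗ y z ⟨
      φ (y K.⊗ z)   ≡⟨ cong φ yz≡1 ⟩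
      φ K.1#        ≡⟨ φ-1 ⟩
      1#            ∎)

    φ-injective : ∀ {y z} → φ y ≡ φ z → y ≡ z
    φ-injective {y} {z} eq = KF.x∙y⁻¹≈ε⇒x≈y y z (φ≡0⇒≡0 _ (begin
      φ (y K.⊕ K.⊖ z)          ≡⟨ φ-⊕ y (K.⊖ z) ⟩
      φ y ⊕ φ (K.⊖ z)          ≡⟨ cong (_⊕ φ (K.⊖ z)) eq ⟩
      φ z ⊕ φ (K.⊖ z)          ≡⟨ φ-⊕ z (K.⊖ z) ⟨
      φ (z K.⊕ K.⊖ z)          ≡⟨ cong φ (KF.-‿inverseʳ z) ⟩
      φ K.0#                   ≡⟨ φ-0 ⟩
      0#                       ∎))

    -- X^(p^a) - X has at most p^a roots, and the image of φ consists of p^a of them.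
    φ-surjective : ∀ x → pow x (p ^ a) ≡ x → ∃ λ y → φ y ≡ x
    φ-surjective x x^q₀≡x with any? (λ y → φ y ≟ x) K.elements
    ... | yes found = let y , _ , eq = find found in y , eq
    -- `x` would be a root besides the whole image, forcing even the leading coefficient `1#` to be
    -- zero.
    ... | no  none  = ⊥-elim (0≢1 (sym (All.lookup zeros (there (there (1∈ e))))))
      where
      -- X^(p^a) - X has the coefficients 0 and -1 followed by those of X^(p^a-2); the subtraction
      -- is exact because a field has at least two elements.
      e : ℕ
      e = p ^ a ∸ 2
      q₀≡2+e : p ^ a ≡ 2 + e
      q₀≡2+e = sym (ℕ.m+[n∸m]≡n (subst (2 ≤_) size₀≡ KF.2≤size))

      monomial : ℕ → List Carrier
      monomial zero    = [ 1# ]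
      monomial (suc k) = 0# ∷ monomial k

      length-monomial : ∀ k → length (monomial k) ≡ suc k
      length-monomial zero    = refl
      length-monomial (suc k) = cong suc (length-monomial k)

      horner-monomial : ∀ k z → horner (monomial k) z ≡ pow z k
      horner-monomial zero    z = ≡.trans (cong (1# ⊕_) (zeroʳ z)) (+-identityʳ 1#)
      horner-monomial (suc k) z = ≡.trans (+-identityˡ _) (cong (z ⊗_) (horner-monomial k z))

      1∈ : ∀ k → 1# ∈ monomial k
      1∈ zero    = here refl
      1∈ (suc k) = there (1∈ k)

      root : ∀ z → pow z (p ^ a) ≡ z → horner (0# ∷ ⊖ 1# ∷ monomial e) z ≡ 0#
      root z z^q₀≡z = begin
        0# ⊕ z ⊗ (⊖ 1# ⊕ z ⊗ horner (monomial e) z)   ≡⟨ +-identityˡ _ ⟩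
        z ⊗ (⊖ 1# ⊕ z ⊗ horner (monomial e) z)        ≡⟨ cong (λ h → z ⊗ (⊖ 1# ⊕ z ⊗ h)) (horner-monomial e z) ⟩
        z ⊗ (⊖ 1# ⊕ pow z (suc e))                    ≡⟨ distribˡ z (⊖ 1#) _ ⟩
        z ⊗ ⊖ 1# ⊕ pow z (2 + e)                      ≡⟨ cong₂ _⊕_ (≡.trans (*-comm z (⊖ 1#)) (-1*x≈-x z))
                                                           (≡.trans (cong (pow z) (sym q₀≡2+e)) z^q₀≡z) ⟩
        ⊖ z ⊕ z                                       ≡⟨ -‿inverseˡ z ⟩
        0#                                            ∎

      image-fixed : ∀ y → pow (φ y) (p ^ a) ≡ φ y
      image-fixed y = ≡.trans (sym (φ-pow y (p ^ a)))
        (cong φ (subst (λ n → K.pow y n ≡ y) size₀≡ (KP.pow-size y)))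

      roots! : Unique (x ∷ map φ K.elements)
      roots! = All.map⁺ (All.map (λ φy≢x x≡φy → φy≢x (sym x≡φy)) (All.¬Any⇒All¬ K.elements none))
             ∷ Unique.map⁺ φ-injective KF.elements!

      zeros : All (_≡ 0#) (0# ∷ ⊖ 1# ∷ monomial e)
      zeros = too-many-roots _ (x ∷ map φ K.elements) roots!
        (ℕ.≤-reflexive (begin
          2 + length (monomial e)              ≡⟨ cong (2 +_) (length-monomial e) ⟩
          suc (2 + e)                          ≡⟨ cong suc q₀≡2+e ⟨
          suc (p ^ a)                          ≡⟨ cong suc (≡.trans KF.length-elements size₀≡) ⟨
          suc (length K.elements)              ≡⟨ cong suc (List.length-map φ K.elements) ⟨
          suc (length (map φ K.elements))      ∎))
        λ { (here refl) → root x x^q₀≡x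
          ; (there z∈)  → let y , _ , eq = ∈-map⁻ φ z∈ in subst (λ z → horner (0# ∷ ⊖ 1# ∷ monomial e) z ≡ 0#) (sym eq)
                            (root (φ y) (image-fixed y)) }

-- Weights and frequencies

module CodeWeights (F : FiniteField) (p m k n : ℕ) where
  open FiniteField F
  open Field F using (elements!)
  open Counting
  open ≡.≡-Reasoning

  nonzero : Carrier → ℕ
  nonzero x = 𝟙 (does (¬? (x ≟ 0#)))

  codewordWeight : Carrier → Carrier → ℕ
  codewordWeight ω γ = ∑ (upTo n) (λ i → nonzero (trace p m (γ ⊗ pow ω (k * i))))

  weight-codeword : ∀ ω γ → weight (codeword p m k n ω γ) ≡ codewordWeight ω γ
  weight-codeword ω γ = begin
    length (filter (λ x → ¬? (x ≟ 0#)) (Vec.toList (codeword p m k n ω γ)))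
      ≡⟨ cong (length ∘ filter (λ x → ¬? (x ≟ 0#))) (toList-tabulate coordinate n) ⟩
    length (filter (λ x → ¬? (x ≟ 0#)) (map coordinate (upTo n)))
      ≡⟨ length-filter≡∑ (λ x → ¬? (x ≟ 0#)) (map coordinate (upTo n)) ⟩
    ∑ (map coordinate (upTo n)) nonzero
      ≡⟨ ∑-map coordinate (upTo n) nonzero ⟩
    codewordWeight ω γ ∎
    where
    coordinate : ℕ → Carrier
    coordinate i = trace p m (γ ⊗ pow ω (k * i))

  freq≡∑ : ∀ ω → (∀ {γ γ′} → codeword p m k n ω γ ≡ codeword p m k n ω γ′ → γ ≡ γ′) →
           ∀ w → freq p m k n ω w ≡ ∑ elements (λ γ → δ w (codewordWeight ω γ))
  freq≡∑ ω inj w = begin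
    length (filter (λ v → weight v ℕ.≟ w) (code p m k n ω))
      ≡⟨ cong (length ∘ filter (λ v → weight v ℕ.≟ w)) (deduplicate-unique (Vec.≡-dec _≟_) (Unique.map⁺ inj elements!)) ⟩
    length (filter (λ v → weight v ℕ.≟ w) (map (codeword p m k n ω) elements))
      ≡⟨ length-filter≡∑ (λ v → weight v ℕ.≟ w) (map (codeword p m k n ω) elements) ⟩
    ∑ (map (codeword p m k n ω) elements) (λ v → δ w (weight v))
      ≡⟨ ∑-map (codeword p m k n ω) elements (λ v → δ w (weight v)) ⟩
    ∑ elements (λ γ → δ w (weight (codeword p m k n ω γ)))
      ≡⟨ ∑-cong elements (λ γ _ → cong (δ w) (weight-codeword ω γ)) ⟩
    ∑ elements (λ γ → δ w (codewordWeight ω γ)) ∎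

  freq-cong : ∀ {ω ω′} → (∀ γ → codeword p m k n ω γ ≡ codeword p m k n ω′ γ) →
              ∀ w → freq p m k n ω w ≡ freq p m k n ω′ w
  freq-cong eq w = cong (λ vs → length (filter (λ v → weight v ℕ.≟ w) (deduplicate (Vec.≡-dec _≟_) vs)))
    (List.map-cong eq elements)

  -- In the field with two elements 0# satisfies IsPrimitive, since pow 0# 0 is 1#.
  nonzero-generator : ∀ {ω} → IsPrimitive ω → 1 ≤ k → k * n ≡ size ∸ 1 →
    ∃ λ ω′ → IsPrimitive ω′ × ω′ ≢ 0# × (∀ γ → codeword p m k n ω γ ≡ codeword p m k n ω′ γ)
  nonzero-generator {ω} prim 1≤k kn≡ with ω ≟ 0#
  ... | no  ω≢0  = ω , prim , ω≢0 , λ _ → refl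
  ... | yes refl = 1# , (λ x x≢0 → 0 , sym (x≡1 x x≢0)) , (0≢1 ∘ sym) , λ γ →
    Vec.tabulate-cong (λ i → cong (λ z → trace p m (γ ⊗ z)) (same i))
    where
    x≡1 : ∀ x → x ≢ 0# → x ≡ 1#
    x≡1 x x≢0 with prim x x≢0
    ... | zero  , eq = sym eq
    ... | suc j , eq = contradiction (≡.trans (sym eq) (Field.zeroˡ F _)) x≢0

    cover : ∀ x → x ∈ 0# ∷ 1# ∷ []
    cover x with x ≟ 0#
    ... | yes x≡0 = here x≡0
    ... | no  x≢0 = there (here (x≡1 x x≢0))

    n≤1 : n ≤ 1
    n≤1 = ℕ.≤-trans (ℕ.m≤n*m n k {{ℕ.>-nonZero 1≤k}})
      (subst (_≤ 1) (sym kn≡) (ℕ.∸-monoˡ-≤ 1 (Field.covers⇒size≤length F cover)))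

    -- The only possible coordinate is i = 0, where both powers are empty products.
    same : ∀ (i : Fin n) → pow 0# (k * toℕ i) ≡ pow 1# (k * toℕ i)
    same i with toℕ i | Fin.toℕ<n i
    ... | zero  | _   rewrite ℕ.*-zeroʳ k = refl
    ... | suc j | j<n = contradiction (ℕ.≤-trans j<n n≤1) λ { (s≤s ()) }

-- Interleaving of codewords over the subfield

module Decomposition
  {p m k n a b c u : ℕ} (pr : Prime p)
  (1≤m : 1 ≤ m) (1≤k : 1 ≤ k) (1≤n : 1 ≤ n) (1≤b : 1 ≤ b) (1≤c : 1 ≤ c)
  (kn≡ : k * n ≡ p ^ m ∸ 1) (m≡ab : m ≡ a * b) (n≡bc : n ≡ b * c) (cu≡ : c * u ≡ p ^ a ∸ 1)
  (n-prim : IsPrimitiveDivisor n p m)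
  (F₀ F : FiniteField) (size₀≡ : FiniteField.size F₀ ≡ p ^ a) (size≡ : FiniteField.size F ≡ p ^ m)
  {ω₀ : FiniteField.Carrier F₀} (prim₀ : FiniteField.IsPrimitive F₀ ω₀) (ω₀≢0 : ω₀ ≢ FiniteField.0# F₀)
  {ω : FiniteField.Carrier F} (prim : FiniteField.IsPrimitive F ω) (ω≢0 : ω ≢ FiniteField.0# F)
  {ξ : FiniteField.Carrier F}
  (conj : Embedding.Conjugate {a = a} {m = m} {b = b} pr m≡ab F₀ F size₀≡ size≡ prim₀ ω₀≢0 prim ω≢0 ξ)
  where

  private
    module K = FiniteField F₀
    module KF = Field F₀
    module KP = KF.Primitive prim₀ ω₀≢0
    module Σℕ = Counting
    module W = CodeWeights F p m k n
    module W₀ = CodeWeights F₀ p a u c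
  open FiniteField F
  open Field F
  open Evaluation F using (pow-fixed)
  open Characteristic {m = m} pr size≡
  open Primitive prim ω≢0
  open Embedding {a = a} {m = m} {b = b} pr m≡ab F₀ F size₀≡ size≡ prim₀ ω₀≢0 prim ω≢0 using (module Homomorphism)
  open Homomorphism conj
  open ≡.≡-Reasoning

  private instance
    b-nonZero : NonZero b
    b-nonZero = ℕ.>-nonZero 1≤b
    c-nonZero : NonZero c
    c-nonZero = ℕ.>-nonZero 1≤c
    k-nonZero : NonZero k
    k-nonZero = ℕ.>-nonZero 1≤k
    kb-nonZero : NonZero (k * b)
    kb-nonZero = ℕ.m*n≢0 k b

  q₀ : ℕ
  q₀ = p ^ a

  g h : Carrier
  g = pow ω k
  h = pow g b

  N≡kbc : N ≡ k * b * c
  N≡kbc = begin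
    size ∸ 1      ≡⟨ cong (_∸ 1) size≡ ⟩
    p ^ m ∸ 1     ≡⟨ kn≡ ⟨
    k * n         ≡⟨ cong (k *_) n≡bc ⟩
    k * (b * c)   ≡⟨ ℕ.*-assoc k b c ⟨
    k * b * c     ∎

  h^≡ω^ : ∀ j → pow h j ≡ pow ω (k * b * j)
  h^≡ω^ j = ≡.trans (cong (λ z → pow z j) (sym (pow-* ω k b))) (sym (pow-* ω (k * b) j))

  h^c≡1 : pow h c ≡ 1#
  h^c≡1 = ≡.trans (h^≡ω^ c) (≡.trans (cong (pow ω) (sym N≡kbc)) pow-N)

  1+cu≡q₀ : suc (c * u) ≡ q₀
  1+cu≡q₀ = ≡.trans (cong suc cu≡) (ℕ.suc-pred q₀ {{ℕ.>-nonZero (p^≢0 a)}})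

  h-fixed : pow h q₀ ≡ h
  h-fixed = begin
    pow h q₀                 ≡⟨ cong (pow h) 1+cu≡q₀ ⟨
    h ⊗ pow h (c * u)        ≡⟨ cong (h ⊗_) (pow-* h c u) ⟩
    h ⊗ pow (pow h c) u      ≡⟨ cong (λ z → h ⊗ pow z u) h^c≡1 ⟩
    h ⊗ pow 1# u             ≡⟨ cong (h ⊗_) (pow-1# u) ⟩
    h ⊗ 1#                   ≡⟨ *-identityʳ h ⟩
    h                        ∎

  q₀^≡ : ∀ l → q₀ ^ l ≡ p ^ (l * a)
  q₀^≡ l = ≡.trans (ℕ.^-*-assoc p a l) (cong (p ^_) (ℕ.*-comm a l))

  size≡q₀^b : size ≡ q₀ ^ b
  size≡q₀^b = ≡.trans size≡ (≡.trans (cong (p ^_) m≡ab) (sym (ℕ.^-*-assoc p a b)))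

  -- The trace from F to its subfield of order p^a.
  relativeTrace : Carrier → Carrier
  relativeTrace z = ∑ (upTo b) (λ l → pow z (q₀ ^ l))

  -- The power q₀ shifts the b conjugates cyclically, as z^(q₀^b) = z. Adding z to both sides turns
  -- the shift into two ways of splitting a sum of b + 1 terms.
  relativeTrace-fixed : ∀ z → pow (relativeTrace z) q₀ ≡ relativeTrace z
  relativeTrace-fixed z = ≡.trans conjugated (∙-cancelˡ z _ _ (begin
    z ⊕ ∑ (upTo b) (f ∘ suc)      ≡⟨ cong (_⊕ ∑ (upTo b) (f ∘ suc)) (pow-1 z) ⟨
    f 0 ⊕ ∑ (upTo b) (f ∘ suc)    ≡⟨ ∑-upTo-suc b f ⟨
    ∑ (upTo (suc b)) f            ≡⟨ ∑-upTo-∷ʳ b f ⟩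
    ∑ (upTo b) f ⊕ f b            ≡⟨ +-comm _ _ ⟩
    f b ⊕ ∑ (upTo b) f            ≡⟨ cong (_⊕ ∑ (upTo b) f) (≡.trans (cong (pow z) (sym size≡q₀^b)) (pow-size z)) ⟩
    z ⊕ ∑ (upTo b) f              ∎))
    where
    f : ℕ → Carrier
    f l = pow z (q₀ ^ l)
    conjugated : pow (relativeTrace z) q₀ ≡ ∑ (upTo b) (f ∘ suc)
    conjugated = ≡.trans (frobenius^-∑ a (upTo b) f) (∑-cong (upTo b) λ l _ →
      ≡.trans (sym (pow-* z (q₀ ^ l) q₀)) (cong (pow z) (ℕ.*-comm (q₀ ^ l) q₀)))

  relativeTrace-⊗ : ∀ z x → pow x q₀ ≡ x → relativeTrace (z ⊗ x) ≡ relativeTrace z ⊗ x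
  relativeTrace-⊗ z x x-fixed = begin
    ∑ (upTo b) (λ l → pow (z ⊗ x) (q₀ ^ l))
      ≡⟨ ∑-cong (upTo b) (λ l _ → begin
           pow (z ⊗ x) (q₀ ^ l)              ≡⟨ pow-⊗ z x (q₀ ^ l) ⟩
           pow z (q₀ ^ l) ⊗ pow x (q₀ ^ l)   ≡⟨ cong (pow z (q₀ ^ l) ⊗_) (pow-fixed q₀ x x-fixed l) ⟩
           pow z (q₀ ^ l) ⊗ x                ≡⟨ *-comm _ x ⟩
           x ⊗ pow z (q₀ ^ l)                ∎) ⟩
    ∑ (upTo b) (λ l → x ⊗ pow z (q₀ ^ l))
      ≡⟨ ⊗-distribˡ-∑ x (upTo b) _ ⟨
    x ⊗ relativeTrace z
      ≡⟨ *-comm x _ ⟩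
    relativeTrace z ⊗ x ∎

  -- Exponents below m = ba are written as la + j, and the inner sum over l is pulled inside the
  -- Frobenius power p^j.
  trace-transitive : ∀ z → trace p m z ≡ trace p a (relativeTrace z)
  trace-transitive z = begin
    trace p m z
      ≡⟨ fsum-map≡∑ (λ i → pow z (p ^ i)) (upTo m) ⟩
    ∑ (upTo m) (λ i → pow z (p ^ i))
      ≡⟨ cong (λ e → ∑ (upTo e) (λ i → pow z (p ^ i))) (≡.trans m≡ab (ℕ.*-comm a b)) ⟩
    ∑ (upTo (b * a)) (λ i → pow z (p ^ i))
      ≡⟨ ∑-upTo-* b a (λ i → pow z (p ^ i)) ⟩
    ∑ (upTo b) (λ l → ∑ (upTo a) (λ j → pow z (p ^ (l * a + j))))
      ≡⟨ ∑-swap (upTo b) (upTo a) (λ l j → pow z (p ^ (l * a + j))) ⟩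
    ∑ (upTo a) (λ j → ∑ (upTo b) (λ l → pow z (p ^ (l * a + j))))
      ≡⟨ ∑-cong (upTo a) (λ j _ → ≡.trans
           (∑-cong (upTo b) λ l _ → begin
             pow z (p ^ (l * a + j))        ≡⟨ cong (pow z) (ℕ.^-distribˡ-+-* p (l * a) j) ⟩
             pow z (p ^ (l * a) * p ^ j)    ≡⟨ cong (λ e → pow z (e * p ^ j)) (q₀^≡ l) ⟨
             pow z (q₀ ^ l * p ^ j)         ≡⟨ pow-* z (q₀ ^ l) (p ^ j) ⟩
             pow (pow z (q₀ ^ l)) (p ^ j)   ∎)
           (sym (frobenius^-∑ j (upTo b) (λ l → pow z (q₀ ^ l))))) ⟩
    ∑ (upTo a) (λ j → pow (relativeTrace z) (p ^ j))
      ≡⟨ fsum-map≡∑ (λ j → pow (relativeTrace z) (p ^ j)) (upTo a) ⟨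
    trace p a (relativeTrace z) ∎

  h₀ : K.Carrier
  h₀ = proj₁ (φ-surjective h h-fixed)

  φ-h₀ : φ h₀ ≡ h
  φ-h₀ = proj₂ (φ-surjective h h-fixed)

  component : Carrier → ℕ → K.Carrier
  component γ r = proj₁ (φ-surjective (relativeTrace (γ ⊗ pow g r)) (relativeTrace-fixed _))

  φ-component : ∀ γ r → φ (component γ r) ≡ relativeTrace (γ ⊗ pow g r)
  φ-component γ r = proj₂ (φ-surjective (relativeTrace (γ ⊗ pow g r)) (relativeTrace-fixed _))

  -- The coordinates jb + r with r fixed form one codeword over the subfield: g^(jb) = h^j is fixed
  -- by the power q₀ and can be taken out of the relative trace.
  coordinate : ∀ γ j r → trace p m (γ ⊗ pow ω (k * (j * b + r))) ≡ φ (K.trace p a (component γ r K.⊗ K.pow h₀ j))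
  coordinate γ j r = begin
    trace p m (γ ⊗ pow ω (k * (j * b + r)))
      ≡⟨ cong (trace p m) split ⟩
    trace p m ((γ ⊗ pow g r) ⊗ pow h j)
      ≡⟨ trace-transitive _ ⟩
    trace p a (relativeTrace ((γ ⊗ pow g r) ⊗ pow h j))
      ≡⟨ cong (trace p a) (relativeTrace-⊗ (γ ⊗ pow g r) (pow h j)
           (≡.trans (pow-comm h j q₀) (cong (λ z → pow z j) h-fixed))) ⟩
    trace p a (relativeTrace (γ ⊗ pow g r) ⊗ pow h j)
      ≡⟨ cong₂ (λ x y → trace p a (x ⊗ pow y j)) (φ-component γ r) φ-h₀ ⟨
    trace p a (φ (component γ r) ⊗ pow (φ h₀) j)
      ≡⟨ cong (λ z → trace p a (φ (component γ r) ⊗ z)) (φ-pow h₀ j) ⟨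
    trace p a (φ (component γ r) ⊗ φ (K.pow h₀ j))
      ≡⟨ cong (trace p a) (φ-⊗ (component γ r) (K.pow h₀ j)) ⟨
    trace p a (φ (component γ r K.⊗ K.pow h₀ j))
      ≡⟨ φ-trace a _ ⟨
    φ (K.trace p a (component γ r K.⊗ K.pow h₀ j)) ∎
    where
    split : γ ⊗ pow ω (k * (j * b + r)) ≡ (γ ⊗ pow g r) ⊗ pow h j
    split = begin
      γ ⊗ pow ω (k * (j * b + r))         ≡⟨ cong (γ ⊗_) (pow-* ω k (j * b + r)) ⟩
      γ ⊗ pow g (j * b + r)               ≡⟨ cong (λ e → γ ⊗ pow g e) (≡.trans (ℕ.+-comm (j * b) r) (cong (r +_) (ℕ.*-comm j b))) ⟩
      γ ⊗ pow g (r + b * j)               ≡⟨ cong (γ ⊗_) (pow-+ g r (b * j)) ⟩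
      γ ⊗ (pow g r ⊗ pow g (b * j))       ≡⟨ *-assoc γ _ _ ⟨
      (γ ⊗ pow g r) ⊗ pow g (b * j)       ≡⟨ cong ((γ ⊗ pow g r) ⊗_) (pow-* g b j) ⟩
      (γ ⊗ pow g r) ⊗ pow h j             ∎

  nonzero-φ : ∀ y → W.nonzero (φ y) ≡ W₀.nonzero y
  nonzero-φ y = Σℕ.𝟙-¬?-cong (φ y ≟ 0#) (y K.≟ K.0#) (φ≡0⇒≡0 y) (λ y≡0 → ≡.trans (cong φ y≡0) φ-0)

  h₀^c≡1 : K.pow h₀ c ≡ K.1#
  h₀^c≡1 = φ-injective (≡.trans (φ-pow h₀ c) (≡.trans (cong (λ z → pow z c) φ-h₀) (≡.trans h^c≡1 (sym φ-1))))

  -- Both lists enumerate the c-th roots of unity of F₀.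
  roots-of-unity : map (K.pow h₀) (upTo c) ↭ map (λ i → K.pow ω₀ (u * i)) (upTo c)
  roots-of-unity = unique-⊆⇒↭
    (subst Unique (sym (List.map-upTo (K.pow h₀) c)) (Unique.applyUpTo⁺₁ (K.pow h₀) c distinct))
    (λ y∈ → let j , _ , eq = ∈-map⁻ (K.pow h₀) y∈ in subst (_∈ map (λ i → K.pow ω₀ (u * i)) (upTo c)) (sym eq) (power j))
    (≡.trans (List.length-map (K.pow h₀) (upTo c)) (sym (List.length-map (λ i → K.pow ω₀ (u * i)) (upTo c))))
    where
    distinct : ∀ {i j} → i < j → j < c → K.pow h₀ i ≢ K.pow h₀ j
    -- Under φ these become ω^(kbi) and ω^(kbj), with exponents below kbc = N.
    distinct {i} {j} i<j j<c eq = pow-injective (ℕ.*-monoʳ-< (k * b) i<j)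
      (subst (k * b * j <_) (sym N≡kbc) (ℕ.*-monoʳ-< (k * b) j<c))
      (≡.trans (sym (φ-h₀^ i)) (≡.trans (cong φ eq) (φ-h₀^ j)))
      where
      φ-h₀^ : ∀ i → φ (K.pow h₀ i) ≡ pow ω (k * b * i)
      φ-h₀^ i = ≡.trans (φ-pow h₀ i) (≡.trans (cong (λ z → pow z i) φ-h₀) (h^≡ω^ i))

    N₀≡uc : KP.N ≡ u * c
    N₀≡uc = ≡.trans (cong (_∸ 1) size₀≡) (≡.trans (sym cu≡) (ℕ.*-comm c u))

    h₀≢0 : h₀ ≢ K.0#
    h₀≢0 eq = pow≢0 b (pow≢0 k ω≢0) (≡.trans (sym φ-h₀) (≡.trans (cong φ eq) φ-0))

    power : ∀ j → K.pow h₀ j ∈ map (λ i → K.pow ω₀ (u * i)) (upTo c)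
    power j with prim₀ (K.pow h₀ j) (KF.pow≢0 j h₀≢0)
    -- The c-th power of ω₀^e is 1, so uc divides ec and e is a multiple tu; then t is reduced
    -- modulo c.
    ... | e , ω₀^e≡h₀^j with *-cancelʳ-∣ {u} {e} c (subst (_∣ e * c) N₀≡uc (KP.pow≡1⇒∣ (e * c) ω₀^ec≡1))
      where
      ω₀^ec≡1 : K.pow ω₀ (e * c) ≡ K.1#
      ω₀^ec≡1 = begin
        K.pow ω₀ (e * c)           ≡⟨ KF.pow-* ω₀ e c ⟩
        K.pow (K.pow ω₀ e) c       ≡⟨ cong (λ z → K.pow z c) ω₀^e≡h₀^j ⟩
        K.pow (K.pow h₀ j) c       ≡⟨ KF.pow-comm h₀ j c ⟩
        K.pow (K.pow h₀ c) j       ≡⟨ cong (λ z → K.pow z j) h₀^c≡1 ⟩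
        K.pow K.1# j               ≡⟨ KF.pow-1# j ⟩
        K.1#                       ∎
    ...   | divides t refl = subst (_∈ map (λ i → K.pow ω₀ (u * i)) (upTo c)) (begin
      K.pow ω₀ (u * (t % c))       ≡⟨ KF.pow-* ω₀ u (t % c) ⟩
      K.pow (K.pow ω₀ u) (t % c)   ≡⟨ KF.pow-% (K.pow ω₀ u) c g₀^c≡1 t ⟩
      K.pow (K.pow ω₀ u) t         ≡⟨ KF.pow-* ω₀ u t ⟨
      K.pow ω₀ (u * t)             ≡⟨ cong (K.pow ω₀) (ℕ.*-comm u t) ⟩
      K.pow ω₀ (t * u)             ≡⟨ ω₀^e≡h₀^j ⟩
      K.pow h₀ j                   ∎)
      (∈-map⁺ (λ i → K.pow ω₀ (u * i)) (∈-upTo⁺ (m%n<n t c)))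
      where
      g₀^c≡1 : K.pow (K.pow ω₀ u) c ≡ K.1#
      g₀^c≡1 = ≡.trans (sym (KF.pow-* ω₀ u c)) (≡.trans (cong (K.pow ω₀) (sym N₀≡uc)) KP.pow-N)

  -- h₀ need not equal ω₀^u, but replacing one by the other only reorders the coordinates.
  component-weight : ∀ y → Σℕ.∑ (upTo c) (λ j → W₀.nonzero (K.trace p a (y K.⊗ K.pow h₀ j))) ≡ W₀.codewordWeight ω₀ y
  component-weight y = begin
    Σℕ.∑ (upTo c) (λ j → F′ (K.pow h₀ j))                      ≡⟨ Σℕ.∑-map (K.pow h₀) (upTo c) F′ ⟨
    Σℕ.∑ (map (K.pow h₀) (upTo c)) F′                          ≡⟨ Σℕ.∑-↭ F′ roots-of-unity ⟩
    Σℕ.∑ (map (λ i → K.pow ω₀ (u * i)) (upTo c)) F′            ≡⟨ Σℕ.∑-map (λ i → K.pow ω₀ (u * i)) (upTo c) F′ ⟩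
    W₀.codewordWeight ω₀ y                                     ∎
    where
    F′ : K.Carrier → ℕ
    F′ x = W₀.nonzero (K.trace p a (y K.⊗ x))

  components : Carrier → Vec K.Carrier b
  components γ = Vec.tabulate (component γ ∘ toℕ)

  weight-components : ∀ γ → W.codewordWeight ω γ ≡ Vec.sum (Vec.map (W₀.codewordWeight ω₀) (components γ))
  weight-components γ = begin
    Σℕ.∑ (upTo n) X
      ≡⟨ cong (λ e → Σℕ.∑ (upTo e) X) (≡.trans n≡bc (ℕ.*-comm b c)) ⟩
    Σℕ.∑ (upTo (c * b)) X
      ≡⟨ Σℕ.∑-upTo-* c b X ⟩
    Σℕ.∑ (upTo c) (λ j → Σℕ.∑ (upTo b) (λ r → X (j * b + r)))
      ≡⟨ Σℕ.∑-swap (upTo c) (upTo b) (λ j r → X (j * b + r)) ⟩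
    Σℕ.∑ (upTo b) (λ r → Σℕ.∑ (upTo c) (λ j → X (j * b + r)))
      ≡⟨ Σℕ.∑-cong (upTo b) (λ r _ → ≡.trans
           (Σℕ.∑-cong (upTo c) λ j _ → ≡.trans (cong W.nonzero (coordinate γ j r)) (nonzero-φ _))
           (component-weight (component γ r))) ⟩
    Σℕ.∑ (upTo b) (λ r → W₀.codewordWeight ω₀ (component γ r))
      ≡⟨ Σℕ.sum-map-tabulate (W₀.codewordWeight ω₀) (component γ) b ⟨
    Vec.sum (Vec.map (W₀.codewordWeight ω₀) (components γ)) ∎
    where
    X : ℕ → ℕ
    X i = W.nonzero (trace p m (γ ⊗ pow ω (k * i)))

  -- Coordinate i depends on γ only through its component i mod b, so the components determine the
  -- codeword, which determines γ.
  components-injective : ∀ {γ γ′} → components γ ≡ components γ′ → γ ≡ γ′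
  components-injective {γ} {γ′} eq = codeword-injective prim ω≢0 k n 1≤k 1≤n 1≤m kn≡ n-prim λ i i<n → begin
    trace p m (γ ⊗ pow ω (k * i))
      ≡⟨ cong (λ e → trace p m (γ ⊗ pow ω (k * e))) (divMod i) ⟩
    trace p m (γ ⊗ pow ω (k * (i / b * b + i % b)))
      ≡⟨ coordinate γ (i / b) (i % b) ⟩
    φ (K.trace p a (component γ (i % b) K.⊗ K.pow h₀ (i / b)))
      ≡⟨ cong (λ y → φ (K.trace p a (y K.⊗ K.pow h₀ (i / b))))
           (tabulate-toℕ-injective (component γ) (component γ′) eq (i % b) (m%n<n i b)) ⟩
    φ (K.trace p a (component γ′ (i % b) K.⊗ K.pow h₀ (i / b)))
      ≡⟨ coordinate γ′ (i / b) (i % b) ⟨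
    trace p m (γ′ ⊗ pow ω (k * (i / b * b + i % b)))
      ≡⟨ cong (λ e → trace p m (γ′ ⊗ pow ω (k * e))) (divMod i) ⟨
    trace p m (γ′ ⊗ pow ω (k * i)) ∎
    where
    divMod : ∀ i → i ≡ i / b * b + i % b
    divMod i = ≡.trans (m≡m%n+[m/n]*n i b) (ℕ.+-comm (i % b) _)

  components-↭ : map components elements ↭ Σℕ.tuples K.elements b
  components-↭ = unique-⊆⇒↭ (Unique.map⁺ components-injective elements!) (λ _ → Σℕ.∈-tuples KF.∈-elements _) (begin
    length (map components elements)      ≡⟨ List.length-map components elements ⟩
    length elements                       ≡⟨ length-elements ⟩
    size                                  ≡⟨ size≡q₀^b ⟩
    q₀ ^ b                                ≡⟨ cong (_^ b) (≡.trans KF.length-elements size₀≡) ⟨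
    length K.elements ^ b                 ≡⟨ Σℕ.length-tuples K.elements b ⟨
    length (Σℕ.tuples K.elements b)       ∎)

  ∑-codewordWeight : ∀ G → Σℕ.∑ elements (λ γ → G (W.codewordWeight ω γ))
    ≡ Σℕ.∑ (Σℕ.tuples K.elements b) (λ t → G (Vec.sum (Vec.map (W₀.codewordWeight ω₀) t)))
  ∑-codewordWeight G = begin
    Σℕ.∑ elements (λ γ → G (W.codewordWeight ω γ))    ≡⟨ Σℕ.∑-cong elements (λ γ _ → cong G (weight-components γ)) ⟩
    Σℕ.∑ elements (λ γ → G′ (components γ))           ≡⟨ Σℕ.∑-map components elements G′ ⟨
    Σℕ.∑ (map components elements) G′                 ≡⟨ Σℕ.∑-↭ G′ components-↭ ⟩
    Σℕ.∑ (Σℕ.tuples K.elements b) G′                  ∎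
    where
    G′ : Vec K.Carrier b → ℕ
    G′ t = G (Vec.sum (Vec.map (W₀.codewordWeight ω₀) t))

-- Several compositions may lead to the same total weight, so the equality is stated for each w with
-- their contributions added up; at a w reached by none, both sides are 0.
theorem2p2 : (p m k n a b c u : ℕ) → Prime p →
    1 ≤ m → 1 ≤ k → 1 ≤ n → 1 ≤ a → 1 ≤ b → 1 ≤ c → 1 ≤ u →
    k * n ≡ p ^ m ∸ 1 → m ≡ a * b → n ≡ b * c → 1 < b → c * u ≡ p ^ a ∸ 1 →
    IsPrimitiveDivisor c p a → IsPrimitiveDivisor n p m → (p ∸ 1) ∣ c →
    (F F₀ : FiniteField) → FiniteField.size F ≡ p ^ m → FiniteField.size F₀ ≡ p ^ a →
    (ω : FiniteField.Carrier F) → FiniteField.IsPrimitive F ω →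
    (ω₀ : FiniteField.Carrier F₀) → FiniteField.IsPrimitive F₀ ω₀ →
    (s : ℕ) (ws : Vec ℕ s) → (∀ i j → lookup ws i ≡ lookup ws j → i ≡ j) →
    (∀ w → FiniteField.IsWeight F₀ p a u c ω₀ w ⇔ ∃ (λ i → lookup ws i ≡ w)) →
    ∀ w → FiniteField.freq F p m k n ω w
          ≡ predictedFreq b ws (Vec.map (FiniteField.freq F₀ p a u c ω₀) ws) w
theorem2p2 p m k n a b c u pr 1≤m 1≤k 1≤n 1≤a 1≤b 1≤c 1≤u kn≡ m≡ab n≡bc _ cu≡ c-prim n-prim _
  F F₀ size≡ size₀≡ ω prim ω₀ prim₀ s ws ws-distinct weights w
  -- Both generators are exchanged for nonzero ones that produce the same codewords, since the order
  -- arguments require ω ≠ 0.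
  with CodeWeights.nonzero-generator F p m k n prim 1≤k (≡.trans kn≡ (cong (_∸ 1) (sym size≡)))
     | CodeWeights.nonzero-generator F₀ p a u c prim₀ 1≤u (≡.trans uc≡ (cong (_∸ 1) (sym size₀≡)))
  where
  uc≡ : u * c ≡ p ^ a ∸ 1
  uc≡ = ≡.trans (ℕ.*-comm u c) cu≡
... | ω′ , prim′ , ω′≢0 , same | ω₀′ , prim₀′ , ω₀′≢0 , same₀ =
  -- Double negation elimination is available because the goal is an equation in ℕ.
  decidable-stable (_ ℕ.≟ _) λ ≢predicted →
    Embedding.conjugate-exists {a = a} {m = m} {b = b} pr m≡ab F₀ F size₀≡ size≡ prim₀′ ω₀′≢0 prim′ ω′≢0 λ (ξ , conj) →
      ≢predicted (begin
        freq p m k n ω w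
          ≡⟨ W.freq-cong same w ⟩
        freq p m k n ω′ w
          ≡⟨ W.freq≡∑ ω′ (λ eq → Characteristic.codeword-injective {m = m} pr size≡ prim′ ω′≢0 k n 1≤k 1≤n 1≤m kn≡ n-prim
               (tabulate-toℕ-injective _ _ eq)) w ⟩
        ∑ elements (λ γ → δ w (W.codewordWeight ω′ γ))
          ≡⟨ Decomposition.∑-codewordWeight {a = a} pr 1≤m 1≤k 1≤n 1≤b 1≤c kn≡ m≡ab n≡bc cu≡ n-prim
               F₀ F size₀≡ size≡ prim₀′ ω₀′≢0 prim′ ω′≢0 conj (δ w) ⟩
        ∑ (tuples K.elements b) (λ t → δ w (Vec.sum (Vec.map (W₀.codewordWeight ω₀′) t)))
          ≡⟨ ∑-tuples K.elements (W₀.codewordWeight ω₀′) (Vec.toList (Vec.zip ws (Vec.map frequencyOf ws)))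
               (∑-by-value K.elements (W₀.codewordWeight ω₀′) ws ws-distinct value) b (δ w) ⟩
        expand (Vec.toList (Vec.zip ws (Vec.map frequencyOf ws))) b (δ w)
          ≡⟨ cong (λ ms → expand (Vec.toList (Vec.zip ws ms)) b (δ w)) (Vec.map-cong freq≡frequencyOf ws) ⟨
        expand (Vec.toList (Vec.zip ws (Vec.map (K.freq p a u c ω₀) ws))) b (δ w)
          ≡⟨ predictedFreq≡expand b ws (Vec.map (K.freq p a u c ω₀) ws) w ⟨
        predictedFreq b ws (Vec.map (K.freq p a u c ω₀) ws) w ∎)
  where
  module K = FiniteField F₀
  module W = CodeWeights F p m k n
  module W₀ = CodeWeights F₀ p a u c
  open FiniteField F
  open Field F using (module Characteristic)
  open Counting
  open ≡.≡-Reasoning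

  value : ∀ y → ∃ λ i → lookup ws i ≡ W₀.codewordWeight ω₀′ y
  value y = Equivalence.to (weights _) (y , ≡.trans (cong K.weight (same₀ y)) (W₀.weight-codeword ω₀′ y))

  frequencyOf : ℕ → ℕ
  frequencyOf w = ∑ K.elements (λ y → δ w (W₀.codewordWeight ω₀′ y))

  -- Primitivity of c makes the small code injective, so its frequencies count elements of `F₀`.
  freq≡frequencyOf : ∀ w → K.freq p a u c ω₀ w ≡ frequencyOf w
  freq≡frequencyOf w = ≡.trans (W₀.freq-cong same₀ w) (W₀.freq≡∑ ω₀′
    (λ eq → Field.Characteristic.codeword-injective F₀ {m = a} pr size₀≡ prim₀′ ω₀′≢0 u c 1≤u 1≤c 1≤a
      (≡.trans (ℕ.*-comm u c) cu≡) c-prim (tabulate-toℕ-injective _ _ eq)) w)
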